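{- Let $0<\epsilon\le \tfrac12$. For every finite simple graph $G$ with $n$ vertices and at least one edge, let $E$ be its set of directed edges and $m=|E|$, and suppose $n$ and $m$ are known to the algorithm. Then the algorithm $\texttt{Sample\_edge}(\epsilon)$ (described in the context), run with query access to $G$ in the standard sublinear graph model, has expected running time $O\!\left(\frac{n}{\sqrt m}\log\frac1\epsilon\right)$ (with an absolute implied constant), and the distribution of the edge in $E$ that it returns is pointwise $\epsilon$-close to the uniform distribution on $E$.
   Context: Graph conventions. $G$ is a finite simple undirected graph with vertex set $V$, $|V|=n$. Each undirected edge $\{u,v\}$ is replaced by the two directed edges $(u,v)$ and $(v,u)$; $E$ is the set of directed edges and $m=|E|$ (so $m$ is the sum of the degrees). $d(v)$ is the number of neighbors of $v$. Standard sublinear graph model. The algorithm accesses $G$ only via: uniform random vertex queries (independent uniform samples from $V$), degree queries (given $v$, return $d(v)$), and neighbor queries (given $v$ and $j\ge 1$, return the $j$th neighbor of $v$ in a fixed ordering of its neighbors, or nothing if $j>d(v)$). Each query and each elementary operation, including drawing a uniform random integer from a given range, takes $O(1)$ time. Light and heavy. Let $\theta=\lceil\sqrt{2m}\rceil$. A vertex $v$ is light if $d(v)\le\theta$ and heavy otherwise. Algorithm $\texttt{Sampling\_attempt}(k)$, for an integer $k\ge1$: (1) sample $u_0\in V$ uniformly at random and query $d(u_0)$; (2) if $d(u_0)>\theta$, return fail; (3) choose $j\in\{1,\dots,\theta\}$ uniformly at random; (4) let $u_1$ be the $j$th neighbor of $u_0$, and return fail if there is no such neighbor; (5) for $i=2,\dots,k$: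 if $u_{i-1}$ is light, return fail; otherwise let $u_i$ be a uniformly random neighbor of $u_{i-1}$; (6) return the directed edge $(u_{k-1},u_k)$. Algorithm $\texttt{Sample\_edge}(\epsilon)$: let $\ell=\lceil\log_2\frac1\epsilon\rceil+1$. Repeat independently: pick $k\in\{1,\dots,\ell\}$ uniformly at random and call $\texttt{Sampling\_attempt}(k)$; stop at the first call that does not fail and return its result. Pointwise closeness. A probability distribution $\mathcal P$ is pointwise $\epsilon$-close to $\mathcal Q$ if $|\mathcal P(x)-\mathcal Q(x)|\le\epsilon\,\mathcal Q(x)$ for all $x$. -}

module Defs where

import Algebra.Definitions.RawSemiring
open import Data.Bool.Base using (if_then_else_)
open import Data.Empty using (⊥)
open import Data.Fin.Base using (Fin; toℕ)
import Data.Fin.Properties as Fin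
open import Data.Integer.Base using (+_; ∣_∣)
open import Data.List.Base
  using (List; allFin; cartesianProduct; drop; filter; foldr; head; length; map)
open import Data.List.Relation.Binary.Permutation.Propositional using (_↭_)
open import Data.Maybe.Base using (Maybe; just; nothing; maybe)
open import Data.Nat.Base as ℕ using (ℕ; zero; suc; _∸_)
import Data.Nat.Properties as ℕ
open import Data.Product.Base using (∃; _×_; _,_; proj₁; proj₂)
open import Data.Product.Properties using (≡-dec)
open import Data.Rational.Base as ℚ
  using (ℚ; 0ℚ; 1ℚ; ½; _/_; _+_; _-_; _*_; _≤_; _<_; ↥_; ↧ₙ_)
open import Data.Sum.Base using (_⊎_; inj₁; inj₂)
open import Level using (0ℓ)
open import Relation.Binary.Core using (Rel)
open import Relation.Binary.Definitions
  using (Decidable; DecidableEquality; Irreflexive; Symmetric)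
open import Relation.Binary.PropositionalEquality using (_≡_)
open import Relation.Nullary.Decidable using (does; yes; no)
open import Relation.Unary using (Pred; _∈_)

module ℚ-RawSemiring = Algebra.Definitions.RawSemiring ℚ.+-*-rawSemiring
open ℚ-RawSemiring using (sum; _^_)

------------------------------------------------------------------------
-- Numbers

fromℕ : ℕ → ℚ
fromℕ k = + k / 1

-- 1/k, with the junk value 0 at k = 0.
recip : ℕ → ℚ
recip zero    = 0ℚ
recip (suc k) = + 1 / suc k

-- The junk value at k = 0 concerns only draws from an empty range, which
-- `sampleEdge` never makes on a graph with an edge.
average : (k : ℕ) → (Fin k → ℚ) → ℚ
average k f = recip k * sum f

infix 4 _⟶_

_⟶_ : (ℕ → ℚ) → ℚ → Set
f ⟶ l = ∀ δ → 0ℚ < δ → ∃ λ N → ∀ t → N ℕ.≤ t → ℚ.∣ f t - l ∣ < δ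

-- Dedekind reals: `below q` means q < x and `above q` means x < q.
record ℝ : Set₁ where
  field
    below above     : Pred ℚ 0ℓ
    below-inhabited : ∃ below
    above-inhabited : ∃ above
    below-down      : ∀ {q r} → q < r → below r → below q
    below-open      : ∀ {q} → below q → ∃ λ r → q < r × below r
    above-up        : ∀ {q r} → q < r → above q → above r
    above-open      : ∀ {r} → above r → ∃ λ q → q < r × above q
    disjoint        : ∀ {q} → below q → above q → ⊥
    located         : ∀ {q r} → q < r → below q ⊎ above r

open ℝ public

-- A nonnegative real x, given as the set of all rationals q with x ≤ q.
UpperCut : Set₁
UpperCut = Pred ℚ 0ℓ

-- n/√m ≤ q  iff  n² ≤ q²m, for m > 0 and q ≥ 0.
_/√_ : ℕ → ℕ → UpperCut
(n /√ m) q = 0ℚ ≤ q × fromℕ (n ℕ.* n) ≤ q * q * fromℕ m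

-- For 0 < ε ≤ 1 and a, b natural with b > 0:
-- log₂(1/ε) ≤ a/b  iff  1 ≤ 2ᵃεᵇ  iff  1 ≤ 2ᵃqᵇ for all rationals q > ε.
log₂1/_ : ℝ → UpperCut
(log₂1/ ε) s =
  0ℚ ≤ s × (∀ q → above ε q → 1ℚ ≤ fromℕ 2 ^ ∣ ↥ s ∣ * q ^ (↧ₙ s))

-- k = ⌈x⌉, for x ≥ 0.
IsCeiling : UpperCut → ℕ → Set
IsCeiling x k = fromℕ k ∈ x × (∀ j → fromℕ j ∈ x → k ℕ.≤ j)

bumpRoot : ℕ → ℕ → ℕ
bumpRoot k r with k ℕ.≤? r ℕ.* r
... | yes _ = r
... | no  _ = suc r

⌈√_⌉ : ℕ → ℕ
⌈√ zero ⌉  = zero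
⌈√ suc k ⌉ = bumpRoot (suc k) ⌈√ k ⌉

⌈√⌉-upper : ∀ k → k ℕ.≤ ⌈√ k ⌉ ℕ.* ⌈√ k ⌉
⌈√⌉-upper zero    = ℕ.z≤n
⌈√⌉-upper (suc k) with suc k ℕ.≤? ⌈√ k ⌉ ℕ.* ⌈√ k ⌉
... | yes p = p
... | no  _ = ℕ.s≤s (ℕ.≤-trans (⌈√⌉-upper k)
  (ℕ.≤-trans (ℕ.*-monoʳ-≤ ⌈√ k ⌉ (ℕ.n≤1+n ⌈√ k ⌉))
             (ℕ.m≤n+m (⌈√ k ⌉ ℕ.* suc ⌈√ k ⌉) ⌈√ k ⌉)))

⌈√⌉-least : ∀ k t → k ℕ.≤ t ℕ.* t → ⌈√ k ⌉ ℕ.≤ t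
⌈√⌉-least zero    t _ = ℕ.z≤n
⌈√⌉-least (suc k) t h with suc k ℕ.≤? ⌈√ k ⌉ ℕ.* ⌈√ k ⌉
... | yes _ = ⌈√⌉-least k t (ℕ.<⇒≤ h)
... | no ¬p = ℕ.≰⇒> λ t≤r → ¬p (ℕ.≤-trans h (ℕ.*-mono-≤ t≤r t≤r))

------------------------------------------------------------------------
-- Graphs

record Graph (n : ℕ) : Set₁ where
  field
    Adj       : Rel (Fin n) 0ℓ
    adj?      : Decidable Adj
    symmetric : Symmetric Adj
    loopless  : Irreflexive _≡_ Adj

module _ {n : ℕ} (G : Graph n) where
  open Graph G

  neighbors : Fin n → List (Fin n)
  neighbors v = filter (adj? v) (allFin n)

  deg : Fin n → ℕ
  deg v = length (neighbors v)

  edges : List (Fin n × Fin n)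
  edges = filter (λ e → adj? (proj₁ e) (proj₂ e))
                 (cartesianProduct (allFin n) (allFin n))

  ∣E∣ : ℕ
  ∣E∣ = length edges

  uniformEdge : Fin n × Fin n → ℚ
  uniformEdge (u , v) = if does (adj? u v) then recip ∣E∣ else 0ℚ

  -- The order in which neighbor queries list the neighbors of each vertex.
  record NeighborOrdering : Set where
    field
      ordered   : Fin n → List (Fin n)
      ordered-↭ : ∀ v → ordered v ↭ neighbors v

open NeighborOrdering

------------------------------------------------------------------------
-- Algorithms with query access to a graph on Fin n

-- Programs do not mention the graph: it is reachable only through queries.
-- `repeat b k` runs b afresh until it yields `just x`, then continues as k x.
data Program (n : ℕ) (A : Set) : Set₁ where
  return       : A → Program n A
  sampleVertex : (Fin n → Program n A) → Program n A
  degree       : Fin n → (ℕ → Program n A) → Program n A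
  neighbor     : Fin n → ℕ → (Maybe (Fin n) → Program n A) → Program n A
  randomFin    : (k : ℕ) → (Fin k → Program n A) → Program n A
  step         : Program n A → Program n A
  repeat       : {B : Set} → Program n (Maybe B) → (B → Program n A) →
                 Program n A

infixl 1 _>>=_

_>>=_ : ∀ {n A B} → Program n A → (A → Program n B) → Program n B
return a       >>= f = f a
sampleVertex k >>= f = sampleVertex (λ v → k v >>= f)
degree v k     >>= f = degree v (λ d → k d >>= f)
neighbor v j k >>= f = neighbor v j (λ w → k w >>= f)
randomFin r k  >>= f = randomFin r (λ i → k i >>= f)
step p         >>= f = step (p >>= f)
repeat b k     >>= f = repeat b (λ x → k x >>= f)

-- The j-th entry, counting from 1.
nth : {A : Set} → List A → ℕ → Maybe A
nth xs zero    = nothing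
nth xs (suc j) = head (drop j xs)

module _ {n : ℕ} {G : Graph n} (O : NeighborOrdering G) where

  -- Either the program has halted, or one unit of time is spent and the
  -- program continues as one of k equally likely programs.
  next : ∀ {A} → Program n A → A ⊎ (∃ λ k → Fin k → Program n A)
  next (return a)       = inj₁ a
  next (sampleVertex k) = inj₂ (n , k)
  next (degree v k)     = inj₂ (1 , λ _ → k (deg G v))
  next (neighbor v j k) = inj₂ (1 , λ _ → k (nth (ordered O v) j))
  next (randomFin r k)  = inj₂ (r , k)
  next (step p)         = inj₂ (1 , λ _ → p)
  next (repeat b k)     = inj₂ (1 , λ _ → b >>= maybe k (repeat b k))

  -- The expectation of min(T, t), where T is the running time.
  truncatedTime : ∀ {A} → ℕ → Program n A → ℚ
  truncatedTime zero    p = 0ℚ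
  truncatedTime (suc t) p with next p
  ... | inj₁ _       = 0ℚ
  ... | inj₂ (k , c) = 1ℚ + average k (λ i → truncatedTime t (c i))

  -- The probability that the program halts within time t and returns x.
  returnsWithin : ∀ {A} → DecidableEquality A → ℕ → Program n A → A → ℚ
  returnsWithin _≟_ t p x with next p
  returnsWithin _≟_ t       p x | inj₁ a = if does (a ≟ x) then 1ℚ else 0ℚ
  returnsWithin _≟_ zero    p x | inj₂ _ = 0ℚ
  returnsWithin _≟_ (suc t) p x | inj₂ (k , c) =
    average k (λ i → returnsWithin _≟_ t (c i) x)

  ExpectedTime : ∀ {A} → Program n A → ℚ → Set
  ExpectedTime p τ = (λ t → truncatedTime t p) ⟶ τ

  OutputLaw : ∀ {A} → DecidableEquality A → Program n A → (A → ℚ) → Set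
  OutputLaw _≟_ p P = ∀ x → (λ t → returnsWithin _≟_ t p x) ⟶ P x

infix 4 _≟ᴱ_

_≟ᴱ_ : ∀ {n} → DecidableEquality (Fin n × Fin n)
_≟ᴱ_ = ≡-dec Fin._≟_ Fin._≟_

-- ∣P x - Q x∣ ≤ ε Q x, where Q x ≥ 0 and ε is approached from above.
PointwiseClose : {X : Set} → ℝ → (P Q : X → ℚ) → Set
PointwiseClose ε P Q = ∀ x q → above ε q → ℚ.∣ P x - Q x ∣ ≤ q * Q x

-- The outcomes of P form the set E almost surely.
IsDistributionOnEdges : ∀ {n} → Graph n → (Fin n × Fin n → ℚ) → Set
IsDistributionOnEdges G P =
  (∀ e → 0ℚ ≤ P e) × foldr _+_ 0ℚ (map P (edges G)) ≡ 1ℚ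

------------------------------------------------------------------------
-- The sampling algorithm

module _ {n : ℕ} where

  Attempt : Set₁
  Attempt = Program n (Maybe (Fin n × Fin n))

  fail : Attempt
  fail = return nothing

  -- i further steps of the walk whose last traversed edge is (u , v).
  walk : (θ i : ℕ) → (u v : Fin n) → Attempt
  walk θ zero    u v = return (just (u , v))
  walk θ (suc i) u v =
    degree v λ d → step (
    if does (d ℕ.≤? θ) then fail else
    randomFin d λ j →
    neighbor v (suc (toℕ j)) λ where
      nothing  → fail
      (just w) → walk θ i v w)

  samplingAttempt : (θ k : ℕ) → Attempt
  samplingAttempt θ k =
    sampleVertex λ u₀ →
    degree u₀ λ d → step (
    if does (d ℕ.≤? θ) then
      (randomFin θ λ j →
       neighbor u₀ (suc (toℕ j)) λ where
         nothing   → fail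
         (just u₁) → walk θ (k ∸ 1) u₀ u₁)
    else fail)

-- The two initial steps pay for computing θ and ℓ.
sampleEdge : (n m ℓ : ℕ) → Program n (Fin n × Fin n)
sampleEdge n m ℓ = step (step (
  repeat (randomFin ℓ λ i → samplingAttempt ⌈√ 2 ℕ.* m ⌉ (suc (toℕ i))) return))

-- Let k = ⌈log₂(1/ε)⌉.  By symmetry of adjacency, the weight that one round gives to an edge
-- (u , v) is 1/(ℓnθ) times the probability that a random walk from u meets a light vertex
-- within k steps.  At most m/θ ≤ θ/2 vertices are heavy, so a heavy vertex has at most half of
-- its neighbors heavy and this probability is 1 if u is light and at least 1 − 2⁻ᵏ otherwise.
-- Heavy vertices carry at most two thirds of the edges, so the total weight is at least
-- (m/ℓnθ)(1 − ⅔ 2⁻ᵏ), and for 2⁻ᵏ ≤ ½ normalization costs a factor of at most 1 + 2⁻ᵏ.  The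
-- walk of a round survives each step with probability at most ½, so a round takes O(1) expected
-- time, and ℓnθ/m = O(ℓn/√m) rounds are expected.
module Submission where

open import Algebra.Bundles using (CommutativeRing)
open import Data.Bool.Base using (false; if_then_else_; true)
open import Data.Empty using (⊥-elim)
open import Data.Fin.Base using (Fin; suc; toℕ; zero)
import Data.Fin.Properties as Fin
open import Data.Integer.Base as ℤ using (+≤+; +<+; +_; -≤+; -[1+_])
import Data.Integer.Properties as ℤ
import Data.Integer.Tactic.RingSolver as ℤ-Solver
open import Data.List.Base
  using (List; []; _++_; _∷_; allFin; cartesianProduct; filter; foldr; length; map; tabulate)
open import Data.List.Relation.Binary.Permutation.Propositional as ↭ using (_↭_)
open import Data.List.Relation.Binary.Permutation.Propositional.Properties using (↭-length)
open import Data.Maybe.Base using (Maybe; just; maybe; nothing)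
open import Data.Nat.Base as ℕ using (ℕ; s≤s; suc; z≤n; zero)
import Data.Nat.Coprimality as Coprimality
import Data.Nat.DivMod as ℕ
import Data.Nat.Properties as ℕ
import Data.Nat.Tactic.RingSolver as ℕ-Solver
open import Data.Product.Base using (∃; _,_; _×_; proj₁; proj₂)
open import Data.Rational.Base
  using (*≤*; -_; 0ℚ; 1/_; 1ℚ; _*_; _+_; _-_; _/_; _<_; _≤_; mkℚ; nonNegative; positive;
         toℚᵘ; ½; ℚ; ↥_; ↧ₙ_)
  renaming (∣_∣ to ℚ∣_∣)
open import Data.Rational.Properties as ℚ hiding (_≟_)
import Data.Rational.Unnormalised.Base as ℚᵘ
import Data.Rational.Unnormalised.Properties as ℚᵘ
open import Data.Sum.Base using (inj₁; inj₂)
open import Level using (0ℓ)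
open import Relation.Binary.Definitions using (DecidableEquality; tri<; tri≈; tri>)
open import Relation.Binary.PropositionalEquality
open import Relation.Nullary.Decidable using (Dec; dec⇒maybe; does; from-yes; no; yes)
open import Relation.Nullary.Negation using (contradiction; ¬_)
import Relation.Unary as Unary
open import Relation.Unary using (_∈_)
open import Tactic.RingSolver using (solve; solve-∀)
open import Tactic.RingSolver.Core.AlmostCommutativeRing
  using (AlmostCommutativeRing; fromCommutativeRing)

open import Algebra.Properties.CommutativeSemiring.Exp
  (CommutativeRing.commutativeSemiring +-*-commutativeRing) using (^-distrib-*)
open import Algebra.Properties.Semiring.Exp
  (CommutativeRing.semiring +-*-commutativeRing) using (^-assocʳ; ^-homo-*)
open import Algebra.Properties.Semiring.Sum (CommutativeRing.semiring +-*-commutativeRing)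
  using (*-distribʳ-sum; *-distribˡ-sum; sum; sum-cong-≗; ∑-comm; ∑-distrib-+)

open import Defs
open NeighborOrdering using (ordered; ordered-↭)
open ℚ-RawSemiring using (_^_)

-- Expected time and output law are limits of truncated expectations, and `repeat` has no bound on
-- its running time. Both are treated as one functional, with a charge per unit of time and a payoff
-- on halting. A round halts within a fixed number D of units, so the truncated value X of the loop
-- satisfies X (t+1) ≤ a + f · X t ≤ X (t+1+D), where f is the failure probability of a round and a
-- its charge and payoff. This forces X to converge to the solution of x = a + f · x.
--
-- The two thirds are what makes the error come out as δ = 2⁻ᵏ. If the weights were only known to
-- lie between 1 - δ and 1, normalization might inflate them by 1/(1 - δ), which exceeds 1 + δ.
-- Averaging the deficit over all edges leaves 1/(1 - ⅔δ), which is at most 1 + δ exactly when δ ≤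
-- ½; ε ≤ ½ guarantees this by forcing k ≥ 1.
--
-- Since ε is a Dedekind real and n/√m and log₂(1/ε) are given by upper cuts, every estimate is made
-- at rationals lying above them.

ring : AlmostCommutativeRing 0ℓ 0ℓ
ring = fromCommutativeRing +-*-commutativeRing λ x → dec⇒maybe (0ℚ ℚ.≟ x)

-- Rational arithmetic

0≤+ : ∀ {a b} → 0ℚ ≤ a → 0ℚ ≤ b → 0ℚ ≤ a + b
0≤+ = +-mono-≤

*-monoʳ-≤ : ∀ {a b} c → 0ℚ ≤ c → a ≤ b → c * a ≤ c * b
*-monoʳ-≤ c 0≤c = *-monoˡ-≤-nonNeg c where instance _ = nonNegative 0≤c

*-monoˡ-≤ : ∀ {a b} c → 0ℚ ≤ c → a ≤ b → a * c ≤ b * c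
*-monoˡ-≤ c 0≤c = *-monoʳ-≤-nonNeg c where instance _ = nonNegative 0≤c

0≤* : ∀ {a b} → 0ℚ ≤ a → 0ℚ ≤ b → 0ℚ ≤ a * b
0≤* {a} {b} 0≤a 0≤b = subst (_≤ a * b) (*-zeroʳ a) (*-monoʳ-≤ a 0≤a 0≤b)

0<* : ∀ {a b} → 0ℚ < a → 0ℚ < b → 0ℚ < a * b
0<* {a} {b} 0<a 0<b = subst (_< a * b) (*-zeroʳ a) (*-monoʳ-<-pos a 0<b)
  where instance _ = positive 0<a

*-cancelˡ-≤ : ∀ {a b} c → 0ℚ < c → c * a ≤ c * b → a ≤ b
*-cancelˡ-≤ c 0<c = *-cancelˡ-≤-pos c where instance _ = positive 0<c

p≤q⇒0≤q-p : ∀ {p q} → p ≤ q → 0ℚ ≤ q - p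
p≤q⇒0≤q-p {p} {q} p≤q = subst (_≤ q - p) (+-inverseʳ p) (+-monoˡ-≤ (- p) p≤q)

≤-by : ∀ {a b} c → 0ℚ ≤ c → b ≡ a + c → a ≤ b
≤-by {a} {b} c 0≤c b≡a+c =
  subst₂ _≤_ (+-identityʳ a) (sym b≡a+c) (+-monoʳ-≤ a 0≤c)

reciprocal : ∀ {p} → 0ℚ < p → ∃ λ r → 0ℚ < r × p * r ≡ 1ℚ
reciprocal {p} 0<p = 1/ p , positive⁻¹ (1/ p) {{1/pos⇒pos p}} , *-inverseʳ p
  where
  instance
    p>0 = positive 0<p
    p≢0 = pos⇒nonZero p

∣-∣≤ : ∀ {p b} → p ≤ b → - p ≤ b → ℚ∣ p ∣ ≤ b
∣-∣≤ {p} {b} p≤b -p≤b with ∣p∣≡p∨∣p∣≡-p p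
... | inj₁ e = subst (_≤ b) (sym e) p≤b
... | inj₂ e = subst (_≤ b) (sym e) -p≤b

toℚᵘ-fromℕ : ∀ k → toℚᵘ (fromℕ k) ℚᵘ.≃ ℚᵘ.mkℚᵘ (+ k) 0
toℚᵘ-fromℕ k = toℚᵘ-fromℚᵘ (ℚᵘ.mkℚᵘ (+ k) 0)

fromℕ-+ : ∀ a b → fromℕ (a ℕ.+ b) ≡ fromℕ a + fromℕ b
fromℕ-+ a b = toℚᵘ-injective (begin
  toℚᵘ (fromℕ (a ℕ.+ b))                    ≈⟨ toℚᵘ-fromℕ (a ℕ.+ b) ⟩
  ℚᵘ.mkℚᵘ (+ (a ℕ.+ b)) 0                    ≈⟨ ℚᵘ.*≡* (lemma (+ a) (+ b)) ⟩
  ℚᵘ.mkℚᵘ (+ a) 0 ℚᵘ.+ ℚᵘ.mkℚᵘ (+ b) 0        ≈⟨ ℚᵘ.+-cong (toℚᵘ-fromℕ a) (toℚᵘ-fromℕ b) ⟨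
  toℚᵘ (fromℕ a) ℚᵘ.+ toℚᵘ (fromℕ b)        ≈⟨ toℚᵘ-homo-+ (fromℕ a) (fromℕ b) ⟨
  toℚᵘ (fromℕ a + fromℕ b)                  ∎)
  where
  open ℚᵘ.≃-Reasoning
  lemma : ∀ x y → (x ℤ.+ y) ℤ.* (+ 1 ℤ.* + 1) ≡ (x ℤ.* + 1 ℤ.+ y ℤ.* + 1) ℤ.* + 1
  lemma = ℤ-Solver.solve-∀

fromℕ-* : ∀ a b → fromℕ (a ℕ.* b) ≡ fromℕ a * fromℕ b
fromℕ-* zero    b = sym (*-zeroˡ (fromℕ b))
fromℕ-* (suc a) b = begin
  fromℕ (b ℕ.+ a ℕ.* b)         ≡⟨ fromℕ-+ b (a ℕ.* b) ⟩
  fromℕ b + fromℕ (a ℕ.* b)     ≡⟨ cong (_+_ (fromℕ b)) (fromℕ-* a b) ⟩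
  fromℕ b + fromℕ a * fromℕ b   ≡⟨ lemma (fromℕ b) (fromℕ a) ⟩
  (1ℚ + fromℕ a) * fromℕ b      ≡⟨ cong (_* fromℕ b) (fromℕ-+ 1 a) ⟨
  fromℕ (suc a) * fromℕ b       ∎
  where
  open ≡-Reasoning
  lemma : ∀ x y → x + y * x ≡ (1ℚ + y) * x
  lemma = solve-∀ ring

0≤fromℕ : ∀ k → 0ℚ ≤ fromℕ k
0≤fromℕ k = nonNegative⁻¹ (fromℕ k) {{normalize-nonNeg k 1}}

fromℕ-mono-≤ : ∀ {a b} → a ℕ.≤ b → fromℕ a ≤ fromℕ b
fromℕ-mono-≤ {a} {b} a≤b = ≤-by (fromℕ (b ℕ.∸ a)) (0≤fromℕ (b ℕ.∸ a))
  (trans (cong fromℕ (sym (ℕ.m+[n∸m]≡n a≤b))) (fromℕ-+ a (b ℕ.∸ a)))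

0<1 : 0ℚ < 1ℚ
0<1 = from-yes (0ℚ ℚ.<? 1ℚ)

0≤½ : 0ℚ ≤ ½
0≤½ = from-yes (0ℚ ℚ.≤? ½)

1≤fromℕ : ∀ {k} → 0 ℕ.< k → 1ℚ ≤ fromℕ k
1≤fromℕ = fromℕ-mono-≤

0<fromℕ : ∀ {k} → 0 ℕ.< k → 0ℚ < fromℕ k
0<fromℕ 0<k = <-≤-trans 0<1 (1≤fromℕ 0<k)

recip-inverse : ∀ {k} → 0 ℕ.< k → recip k * fromℕ k ≡ 1ℚ
recip-inverse {suc k} _ = toℚᵘ-injective (begin
  toℚᵘ (recip (suc k) * fromℕ (suc k))             ≈⟨ toℚᵘ-homo-* (recip (suc k)) (fromℕ (suc k)) ⟩
  toℚᵘ (recip (suc k)) ℚᵘ.* toℚᵘ (fromℕ (suc k))    ≈⟨ ℚᵘ.*-cong (toℚᵘ-fromℚᵘ (ℚᵘ.mkℚᵘ (+ 1) k)) (toℚᵘ-fromℕ (suc k)) ⟩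
  ℚᵘ.mkℚᵘ (+ 1) k ℚᵘ.* ℚᵘ.mkℚᵘ (+ suc k) 0          ≈⟨ ℚᵘ.*≡* (lemma (+ suc k)) ⟩
  toℚᵘ 1ℚ                                          ∎)
  where
  open ℚᵘ.≃-Reasoning
  lemma : ∀ x → (+ 1 ℤ.* x) ℤ.* + 1 ≡ + 1 ℤ.* (x ℤ.* + 1)
  lemma = ℤ-Solver.solve-∀

0≤recip : ∀ k → 0ℚ ≤ recip k
0≤recip zero    = ≤-refl
0≤recip (suc k) = nonNegative⁻¹ (recip (suc k)) {{normalize-nonNeg 1 (suc k)}}

0<recip : ∀ {k} → 0 ℕ.< k → 0ℚ < recip k
0<recip {suc k} _ = positive⁻¹ (recip (suc k)) {{normalize-pos 1 (suc k)}}

-- Sums and averages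

sum-0 : ∀ n → sum {n} (λ _ → 0ℚ) ≡ 0ℚ
sum-0 zero    = refl
sum-0 (suc n) = trans (+-identityˡ _) (sum-0 n)

sum-const : ∀ n x → sum {n} (λ _ → x) ≡ fromℕ n * x
sum-const zero    x = sym (*-zeroˡ x)
sum-const (suc n) x = begin
  x + sum {n} (λ _ → x)  ≡⟨ cong (_+_ x) (sum-const n x) ⟩
  x + fromℕ n * x        ≡⟨ lemma x (fromℕ n) ⟩
  (1ℚ + fromℕ n) * x     ≡⟨ cong (_* x) (fromℕ-+ 1 n) ⟨
  fromℕ (suc n) * x      ∎
  where
  open ≡-Reasoning
  lemma : ∀ x y → x + y * x ≡ (1ℚ + y) * x
  lemma = solve-∀ ring

sum-mono : ∀ {n} {f g : Fin n → ℚ} → (∀ i → f i ≤ g i) → sum f ≤ sum g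
sum-mono {zero}  f≤g = ≤-refl
sum-mono {suc n} f≤g = +-mono-≤ (f≤g zero) (sum-mono (λ i → f≤g (suc i)))

sum-nonneg : ∀ {n} {f : Fin n → ℚ} → (∀ i → 0ℚ ≤ f i) → 0ℚ ≤ sum f
sum-nonneg {n} {f} 0≤f = subst (_≤ sum f) (sum-0 n) (sum-mono 0≤f)

sum-linear : ∀ {n} (f g : Fin n → ℚ) x → sum (λ i → f i + x * g i) ≡ sum f + x * sum g
sum-linear f g x =
  trans (∑-distrib-+ f (λ i → x * g i)) (cong (_+_ (sum f)) (sym (*-distribˡ-sum x g)))

average-cong : ∀ k {f g : Fin k → ℚ} → (∀ i → f i ≡ g i) → average k f ≡ average k g
average-cong k f≗g = cong (recip k *_) (sum-cong-≗ f≗g)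

average-mono : ∀ k {f g : Fin k → ℚ} → (∀ i → f i ≤ g i) → average k f ≤ average k g
average-mono k f≤g = *-monoʳ-≤ (recip k) (0≤recip k) (sum-mono f≤g)

average-nonneg : ∀ k {f : Fin k → ℚ} → (∀ i → 0ℚ ≤ f i) → 0ℚ ≤ average k f
average-nonneg k 0≤f = 0≤* (0≤recip k) (sum-nonneg 0≤f)

average-linear : ∀ k (f g : Fin k → ℚ) x →
                 average k (λ i → f i + x * g i) ≡ average k f + x * average k g
average-linear k f g x = trans (cong (recip k *_) (sum-linear f g x))
                               (lemma (recip k) (sum f) x (sum g))
  where
  lemma : ∀ r a x b → r * (a + x * b) ≡ r * a + x * (r * b)
  lemma = solve-∀ ring

average-const : ∀ {k} x → 0 ℕ.< k → average k (λ _ → x) ≡ x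
average-const {k} x 0<k = begin
  recip k * sum {k} (λ _ → x)  ≡⟨ cong (recip k *_) (sum-const k x) ⟩
  recip k * (fromℕ k * x)      ≡⟨ *-assoc (recip k) (fromℕ k) x ⟨
  recip k * fromℕ k * x        ≡⟨ cong (_* x) (recip-inverse 0<k) ⟩
  1ℚ * x                       ≡⟨ *-identityˡ x ⟩
  x                            ∎
  where open ≡-Reasoning

average-≤ : ∀ k {f : Fin k → ℚ} {b} → 0ℚ ≤ b → (∀ i → f i ≤ b) → average k f ≤ b
average-≤ zero    {f} {b} 0≤b f≤b = subst (_≤ b) (sym (*-zeroˡ 0ℚ)) 0≤b
average-≤ (suc k) {f} {b} 0≤b f≤b =
  subst (average (suc k) f ≤_) (average-const {suc k} b (s≤s z≤n)) (average-mono (suc k) f≤b)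

-- Limits of geometric recurrences

archimedean : ∀ x → ∃ λ k → x < fromℕ k
archimedean x@(mkℚ n d _) = suc ℤ.∣ n ∣ , toℚᵘ-cancel-<
  (ℚᵘ.<-respʳ-≃ (ℚᵘ.≃-sym (toℚᵘ-fromℕ (suc ℤ.∣ n ∣))) (ℚᵘ.*<* n<k))
  where
  n≤∣n∣ : ∀ i → i ℤ.≤ + ℤ.∣ i ∣
  n≤∣n∣ (+ _)    = ℤ.≤-refl
  n≤∣n∣ -[1+ _ ] = -≤+
  n<k : n ℤ.* + 1 ℤ.< + suc ℤ.∣ n ∣ ℤ.* + suc d
  n<k = begin-strict
    n ℤ.* + 1                    ≡⟨ ℤ.*-identityʳ n ⟩
    n                            ≤⟨ n≤∣n∣ n ⟩
    + ℤ.∣ n ∣                    <⟨ +<+ (ℕ.n<1+n ℤ.∣ n ∣) ⟩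
    + suc ℤ.∣ n ∣                ≤⟨ +≤+ (ℕ.m≤m*n (suc ℤ.∣ n ∣) (suc d)) ⟩
    + (suc ℤ.∣ n ∣ ℕ.* suc d)    ≡⟨ ℤ.pos-* (suc ℤ.∣ n ∣) (suc d) ⟩
    + suc ℤ.∣ n ∣ ℤ.* + suc d    ∎
    where open ℤ.≤-Reasoning

^-nonneg : ∀ {q} i → 0ℚ ≤ q → 0ℚ ≤ q ^ i
^-nonneg zero    0≤q = <⇒≤ 0<1
^-nonneg (suc i) 0≤q = 0≤* 0≤q (^-nonneg i 0≤q)

-- Since f = 1 - p, the product (1 + (i+1)p)f falls short of 1 + ip by (i+1)p². This is the explicit
-- rate of decay of fⁱ that the δ-N form of `_⟶_` requires.
bernoulli : ∀ {f p} → 0ℚ ≤ f → f + p ≡ 1ℚ → ∀ i → (1ℚ + fromℕ i * p) * f ^ i ≤ 1ℚ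
bernoulli {f} {p} 0≤f f+p≡1 zero    = ≤-reflexive (solve (p ∷ []) ring)
bernoulli {f} {p} 0≤f f+p≡1 (suc i) = begin
  (1ℚ + fromℕ (suc i) * p) * (f * f ^ i)      ≡⟨ cong (λ x → (1ℚ + x * p) * (f * f ^ i)) (fromℕ-+ 1 i) ⟩
  (1ℚ + (1ℚ + fromℕ i) * p) * (f * f ^ i)     ≤⟨ ≤-by ((1ℚ + fromℕ i) * (p * p) * f ^ i)
                                                  (0≤* (0≤* (0≤+ (<⇒≤ 0<1) (0≤fromℕ i)) 0≤p²) (^-nonneg i 0≤f))
                                                  (lemma (fromℕ i) (f ^ i) f p f+p≡1) ⟩
  (1ℚ + fromℕ i * p) * f ^ i                  ≤⟨ bernoulli 0≤f f+p≡1 i ⟩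
  1ℚ                                          ∎
  where
  open ≤-Reasoning
  0≤p² : 0ℚ ≤ p * p
  0≤p² with ≤-total 0ℚ p
  ... | inj₁ 0≤p = 0≤* 0≤p 0≤p
  ... | inj₂ p≤0 = subst (0ℚ ≤_) (neg² p) (0≤* (neg-antimono-≤ p≤0) (neg-antimono-≤ p≤0))
    where
    neg² : ∀ x → - x * - x ≡ x * x
    neg² = solve-∀ ring
  identity : ∀ i y p → (1ℚ + i * p) * y ≡
    (1ℚ + (1ℚ + i) * p) * ((1ℚ - p) * y) + (1ℚ + i) * (p * p) * y
  identity = solve-∀ ring
  lemma : ∀ i y f p → f + p ≡ 1ℚ → (1ℚ + i * p) * y ≡
    (1ℚ + (1ℚ + i) * p) * (f * y) + (1ℚ + i) * (p * p) * y
  lemma i y f p e = trans (identity i y p)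
    (cong (λ x → (1ℚ + (1ℚ + i) * p) * (x * y) + (1ℚ + i) * (p * p) * y) (sym f≡1-p))
    where
    add-sub : ∀ f p → f ≡ f + p - p
    add-sub = solve-∀ ring
    f≡1-p : f ≡ 1ℚ - p
    f≡1-p = trans (add-sub f p) (cong (_- p) e)

m+n≤o⇒n≤o∸m : ∀ m {n o} → m ℕ.+ n ℕ.≤ o → n ℕ.≤ o ℕ.∸ m
m+n≤o⇒n≤o∸m m {n} {o} h = ℕ.m+n≤o⇒m≤o∸n n (subst (ℕ._≤ o) (ℕ.+-comm m n) h)

∣-∣< : ∀ {p b} → p < b → - p < b → ℚ∣ p ∣ < b
∣-∣< {p} {b} p<b -p<b with ∣p∣≡p∨∣p∣≡-p p
... | inj₁ e = subst (_< b) (sym e) p<b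
... | inj₂ e = subst (_< b) (sym e) -p<b

module _
  {X : ℕ → ℚ} {c f p L : ℚ} (D : ℕ)
  (0≤c : 0ℚ ≤ c) (0≤f : 0ℚ ≤ f) (0<p : 0ℚ < p) (f+p≡1 : f + p ≡ 1ℚ) (pL≡c : p * L ≡ c)
  (X₀≡0 : X 0 ≡ 0ℚ) (0≤X : ∀ t → 0ℚ ≤ X t)
  (X≤ : ∀ t → X (suc t) ≤ c + f * X t) (≤X : ∀ t → c + f * X t ≤ X (suc (D ℕ.+ t)))
  where

  private
    0≤L : 0ℚ ≤ L
    0≤L = *-cancelˡ-≤ p 0<p (subst₂ _≤_ (sym (*-zeroʳ p)) (sym pL≡c) 0≤c)

    fixpoint : c + f * L ≡ L
    fixpoint = begin
      c + f * L      ≡⟨ cong (_+ f * L) pL≡c ⟨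
      p * L + f * L  ≡⟨ solve (p ∷ f ∷ L ∷ []) ring ⟩
      (f + p) * L    ≡⟨ cong (_* L) f+p≡1 ⟩
      1ℚ * L         ≡⟨ *-identityˡ L ⟩
      L              ∎
      where open ≡-Reasoning

    upper : ∀ t → X t ≤ L
    upper zero    = subst (_≤ L) (sym X₀≡0) 0≤L
    upper (suc t) = begin
      X (suc t)    ≤⟨ X≤ t ⟩
      c + f * X t  ≤⟨ +-monoʳ-≤ c (*-monoʳ-≤ f 0≤f (upper t)) ⟩
      c + f * L    ≡⟨ fixpoint ⟩
      L            ∎
      where open ≤-Reasoning

    -- Each use of the lower recurrence takes `suc D` units of time and shrinks the possible gap
    -- below L by the factor f; the gap starts at most at L because X is nonnegative.
    lower : ∀ i t → i ℕ.* suc D ℕ.≤ t → L ≤ X t + f ^ i * L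
    lower zero    t _ = ≤-by (X t) (0≤X t) (identity (X t) L)
      where
      identity : ∀ x L → x + 1ℚ * L ≡ L + x
      identity = solve-∀ ring
    lower (suc i) t h = subst (λ t → L ≤ X t + f ^ suc i * L) (ℕ.m+[n∸m]≡n (ℕ.m+n≤o⇒m≤o (suc D) h)) (begin
      L                                              ≡⟨ fixpoint ⟨
      c + f * L
        ≤⟨ +-monoʳ-≤ c (*-monoʳ-≤ f 0≤f (lower i t′ (m+n≤o⇒n≤o∸m (suc D) h))) ⟩
      c + f * (X t′ + f ^ i * L)                     ≡⟨ identity c f (X t′) (f ^ i) L ⟩
      (c + f * X t′) + f ^ suc i * L                 ≤⟨ +-monoˡ-≤ (f ^ suc i * L) (≤X t′) ⟩
      X (suc D ℕ.+ t′) + f ^ suc i * L               ∎)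
      where
      open ≤-Reasoning
      t′ = t ℕ.∸ suc D
      identity : ∀ c f x y L → c + f * (x + y * L) ≡ (c + f * x) + f * y * L
      identity = solve-∀ ring

  geometric-limit : X ⟶ L
  geometric-limit δ 0<δ = i ℕ.* suc D , λ t h → ∣-∣<
    (≤-<-trans (subst (X t - L ≤_) (+-inverseʳ L) (+-monoˡ-≤ (- L) (upper t))) 0<δ)
    (≤-<-trans (≤-by (X t + f ^ i * L - L) (p≤q⇒0≤q-p (lower i t h)) (identity (X t) L (f ^ i * L))) small)
    where
    -- With r = 1/(pδ) and i > L·r, one gets L < ipδ < (1 + ip)δ, and Bernoulli's inequality turns
    -- this into fⁱL < δ.
    r = proj₁ (reciprocal (0<* 0<p 0<δ))
    0<r = proj₁ (proj₂ (reciprocal (0<* 0<p 0<δ)))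
    pδr≡1 = proj₂ (proj₂ (reciprocal (0<* 0<p 0<δ)))
    i = proj₁ (archimedean (L * r))
    identity : ∀ x L y → y ≡ - (x - L) + (x + y - L)
    identity = solve-∀ ring
    scale = 1ℚ + fromℕ i * p
    0<pδ = 0<* 0<p 0<δ
    L<scale*δ : L < scale * δ
    L<scale*δ = begin-strict
      L                    ≡⟨ *-identityˡ L ⟨
      1ℚ * L               ≡⟨ cong (_* L) pδr≡1 ⟨
      (p * δ) * r * L      ≡⟨ assoc′ (p * δ) r L ⟩
      (p * δ) * (L * r)    <⟨ *-monoʳ-<-pos (p * δ) {{positive 0<pδ}} (proj₂ (archimedean (L * r))) ⟩
      (p * δ) * fromℕ i    ≤⟨ ≤-by δ (<⇒≤ 0<δ) (expand p δ (fromℕ i)) ⟩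
      scale * δ            ∎
      where
      open ≤-Reasoning
      assoc′ : ∀ x y z → x * y * z ≡ x * (z * y)
      assoc′ = solve-∀ ring
      expand : ∀ p δ i → (1ℚ + i * p) * δ ≡ (p * δ) * i + δ
      expand = solve-∀ ring
    0≤scale : 0ℚ ≤ scale
    0≤scale = 0≤+ (<⇒≤ 0<1) (0≤* (0≤fromℕ i) (<⇒≤ 0<p))
    small : f ^ i * L < δ
    small = *-cancelˡ-<-nonNeg scale {{nonNegative 0≤scale}} (begin-strict
      scale * (f ^ i * L)  ≡⟨ *-assoc scale (f ^ i) L ⟨
      scale * f ^ i * L    ≤⟨ *-monoˡ-≤ L 0≤L (bernoulli 0≤f f+p≡1 i) ⟩
      1ℚ * L               ≡⟨ *-identityˡ L ⟩
      L                    <⟨ L<scale*δ ⟩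
      scale * δ            ∎)
      where open ≤-Reasoning

limit-delay : ∀ {X Y : ℕ → ℚ} {l} d a → (∀ t → Y (d ℕ.+ t) ≡ a + X t) → X ⟶ l → Y ⟶ a + l
limit-delay {X} {Y} {l} d a shift X⟶l δ 0<δ = d ℕ.+ N , λ t h →
  subst (λ x → ℚ∣ x ∣ < δ) (sym (difference t (ℕ.m+n≤o⇒m≤o d h)))
    (proj₂ (X⟶l δ 0<δ) (t ℕ.∸ d) (m+n≤o⇒n≤o∸m d h))
  where
  N = proj₁ (X⟶l δ 0<δ)
  cancel : ∀ a x l → (a + x) - (a + l) ≡ x - l
  cancel = solve-∀ ring
  difference : ∀ t → d ℕ.≤ t → Y t - (a + l) ≡ X (t ℕ.∸ d) - l
  difference t d≤t = trans
    (cong (_- (a + l)) (trans (cong Y (sym (ℕ.m+[n∸m]≡n d≤t))) (shift (t ℕ.∸ d))))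
    (cancel a (X (t ℕ.∸ d)) l)

limit-cong : ∀ {X Y : ℕ → ℚ} {l} → (∀ t → X t ≡ Y t) → X ⟶ l → Y ⟶ l
limit-cong {l = l} X≗Y X⟶l δ 0<δ = proj₁ (X⟶l δ 0<δ) , λ t h →
  subst (λ x → ℚ∣ x - l ∣ < δ) (X≗Y t) (proj₂ (X⟶l δ 0<δ) t h)

-- Truncated and exact expectations of programs

-- There is no constructor for `repeat`, and the bound must hold for all conceivable answers to
-- queries, so it does not depend on the graph.
data HaltsWithin {n A} : ℕ → Program n A → Set₁ where
  return       : ∀ {d} a → HaltsWithin d (return a)
  sampleVertex : ∀ {d k} → (∀ v → HaltsWithin d (k v)) → HaltsWithin (suc d) (sampleVertex k)
  degree       : ∀ {d k} v → (∀ x → HaltsWithin d (k x)) → HaltsWithin (suc d) (degree v k)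
  neighbor     : ∀ {d k} v j → (∀ w → HaltsWithin d (k w)) → HaltsWithin (suc d) (neighbor v j k)
  randomFin    : ∀ {d} r {k} → (∀ i → HaltsWithin d (k i)) → HaltsWithin (suc d) (randomFin r k)
  step         : ∀ {d p} → HaltsWithin d p → HaltsWithin (suc d) (step p)

HaltsWithin-mono : ∀ {n A d e} {p : Program n A} → d ℕ.≤ e → HaltsWithin d p → HaltsWithin e p
HaltsWithin-mono d≤e       (return a)       = return a
HaltsWithin-mono (s≤s d≤e) (sampleVertex h) = sampleVertex λ v → HaltsWithin-mono d≤e (h v)
HaltsWithin-mono (s≤s d≤e) (degree v h)     = degree v λ x → HaltsWithin-mono d≤e (h x)
HaltsWithin-mono (s≤s d≤e) (neighbor v j h) = neighbor v j λ w → HaltsWithin-mono d≤e (h w)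
HaltsWithin-mono (s≤s d≤e) (randomFin r h)  = randomFin r λ i → HaltsWithin-mono d≤e (h i)
HaltsWithin-mono (s≤s d≤e) (step h)         = step (HaltsWithin-mono d≤e h)

isNothing : ∀ {A : Set} → Maybe A → ℚ
isNothing = maybe (λ _ → 0ℚ) 1ℚ

average₁ : ∀ x → average 1 (λ _ → x) ≡ x
average₁ x = average-const {1} x (s≤s z≤n)

module _ {n : ℕ} {G : Graph n} (O : NeighborOrdering G) where

  -- truncatedTime and returnsWithin are both of this form: `c` is charged per
  -- unit of time, and `g` on halting within time t.
  valueWithin : ∀ {A} → (A → ℚ) → ℚ → ℕ → Program n A → ℚ
  valueWithin g c t p with next O p
  valueWithin g c t       p | inj₁ a       = g a
  valueWithin g c zero    p | inj₂ _       = 0ℚ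
  valueWithin g c (suc t) p | inj₂ (k , q) = c + average k (λ i → valueWithin g c t (q i))

  valueWithin-time : ∀ {A} t (p : Program n A) → valueWithin (λ _ → 0ℚ) 1ℚ t p ≡ truncatedTime O t p
  valueWithin-time zero    p with next O p
  ... | inj₁ _       = refl
  ... | inj₂ _       = refl
  valueWithin-time (suc t) p with next O p
  ... | inj₁ _       = refl
  ... | inj₂ (k , q) = cong (_+_ 1ℚ) (average-cong k (λ i → valueWithin-time t (q i)))

  valueWithin-returns : ∀ {A} (_≟_ : DecidableEquality A) x t (p : Program n A) →
    valueWithin (λ a → if does (a ≟ x) then 1ℚ else 0ℚ) 0ℚ t p ≡ returnsWithin O _≟_ t p x
  valueWithin-returns _≟_ x t       p with next O p
  valueWithin-returns _≟_ x t       p | inj₁ _       = refl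
  valueWithin-returns _≟_ x zero    p | inj₂ _       = refl
  valueWithin-returns _≟_ x (suc t) p | inj₂ (k , q) =
    trans (+-identityˡ _) (average-cong k (λ i → valueWithin-returns _≟_ x t (q i)))

  -- The limit of valueWithin on programs without `repeat`, on which it takes the junk value 0.
  value : ∀ {A} → (A → ℚ) → ℚ → Program n A → ℚ
  value g c (return a)       = g a
  value g c (sampleVertex k) = c + average n (λ v → value g c (k v))
  value g c (degree v k)     = c + value g c (k (deg G v))
  value g c (neighbor v j k) = c + value g c (k (nth (ordered O v) j))
  value g c (randomFin r k)  = c + average r (λ i → value g c (k i))
  value g c (step p)         = c + value g c p
  value g c (repeat b k)     = 0ℚ

  value-cong : ∀ {A} {g h : A → ℚ} {c} → (∀ a → g a ≡ h a) → ∀ p → value g c p ≡ value h c p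
  value-cong         g≗h (return a)       = g≗h a
  value-cong {c = c} g≗h (sampleVertex k) = cong (_+_ c) (average-cong n (λ v → value-cong g≗h (k v)))
  value-cong {c = c} g≗h (degree v k)     = cong (_+_ c) (value-cong g≗h (k (deg G v)))
  value-cong {c = c} g≗h (neighbor v j k) = cong (_+_ c) (value-cong g≗h (k (nth (ordered O v) j)))
  value-cong {c = c} g≗h (randomFin r k)  = cong (_+_ c) (average-cong r (λ i → value-cong g≗h (k i)))
  value-cong {c = c} g≗h (step p)         = cong (_+_ c) (value-cong g≗h p)
  value-cong         g≗h (repeat b k)     = refl

  -- Time is charged only once, so the charge goes with `g`, and `h` is valued free of charge. With
  -- `h = isNothing` this separates the retry term of a round, in which `x` multiplies the failure
  -- probability.
  value-linear : ∀ {A} (g h : A → ℚ) c x p →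
                 value (λ a → g a + x * h a) c p ≡ value g c p + x * value h 0ℚ p
  value-linear {A} g h c x = go
    where
    charge : ∀ {y} u v → y ≡ u + x * v → c + y ≡ (c + u) + x * (0ℚ + v)
    charge u v refl = identity c u x v
      where
      identity : ∀ c u x v → c + (u + x * v) ≡ (c + u) + x * (0ℚ + v)
      identity = solve-∀ ring
    chargeAverage : ∀ k {f} (u v : Fin k → ℚ) → (∀ i → f i ≡ u i + x * v i) →
                    c + average k f ≡ (c + average k u) + x * (0ℚ + average k v)
    chargeAverage k u v e = charge (average k u) (average k v)
      (trans (average-cong k e) (average-linear k u v x))
    go : ∀ p → value (λ a → g a + x * h a) c p ≡ value g c p + x * value h 0ℚ p
    go (return a)       = refl
    go (sampleVertex k) = chargeAverage n (λ v → value g c (k v)) (λ v → value h 0ℚ (k v)) (λ v → go (k v))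
    go (degree v k)     = charge (value g c (k (deg G v))) (value h 0ℚ (k (deg G v))) (go (k (deg G v)))
    go (neighbor v j k) = charge (value g c (k w)) (value h 0ℚ (k w)) (go (k w))
      where w = nth (ordered O v) j
    go (randomFin r k)  = chargeAverage r (λ i → value g c (k i)) (λ i → value h 0ℚ (k i)) (λ i → go (k i))
    go (step p)         = charge (value g c p) (value h 0ℚ p) (go p)
    go (repeat b k)     = sym (trans (+-identityˡ (x * 0ℚ)) (*-zeroʳ x))

  module _ {A : Set} {g : A → ℚ} {c : ℚ} (0≤g : ∀ a → 0ℚ ≤ g a) (0≤c : 0ℚ ≤ c) where

    valueWithin-nonneg : ∀ t p → 0ℚ ≤ valueWithin g c t p
    valueWithin-nonneg t       p with next O p
    valueWithin-nonneg t       p | inj₁ a       = 0≤g a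
    valueWithin-nonneg zero    p | inj₂ _       = ≤-refl
    valueWithin-nonneg (suc t) p | inj₂ (k , q) =
      0≤+ 0≤c (average-nonneg k (λ i → valueWithin-nonneg t (q i)))

    valueWithin-mono : ∀ {s t} → s ℕ.≤ t → ∀ p → valueWithin g c s p ≤ valueWithin g c t p
    valueWithin-mono {s} {t} s≤t p with next O p in eq
    valueWithin-mono s≤t       p | inj₁ a       = ≤-refl
    valueWithin-mono {_} {zero}  z≤n p | inj₂ _       = ≤-refl
    valueWithin-mono {_} {suc t} z≤n p | inj₂ (k , q) =
      0≤+ 0≤c (average-nonneg k (λ i → valueWithin-nonneg t (q i)))
    valueWithin-mono (s≤s s≤t) p | inj₂ (k , q) =
      +-monoʳ-≤ c (average-mono k (λ i → valueWithin-mono s≤t (q i)))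

    value-nonneg : ∀ p → 0ℚ ≤ value g c p
    value-nonneg (return a)       = 0≤g a
    value-nonneg (sampleVertex k) = 0≤+ 0≤c (average-nonneg n (λ v → value-nonneg (k v)))
    value-nonneg (degree v k)     = 0≤+ 0≤c (value-nonneg (k (deg G v)))
    value-nonneg (neighbor v j k) = 0≤+ 0≤c (value-nonneg (k (nth (ordered O v) j)))
    value-nonneg (randomFin r k)  = 0≤+ 0≤c (average-nonneg r (λ i → value-nonneg (k i)))
    value-nonneg (step p)         = 0≤+ 0≤c (value-nonneg p)
    value-nonneg (repeat b k)     = ≤-refl

  module _ {A : Set} {g : A → ℚ} {c : ℚ} (0≤g : ∀ a → 0ℚ ≤ g a) (0≤c : 0ℚ ≤ c)
           {B : Set} (f : B → Program n A) (t : ℕ) where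

    private
      g′ : B → ℚ
      g′ b = valueWithin g c t (f b)

      0≤g′ : ∀ b → 0ℚ ≤ g′ b
      0≤g′ b = valueWithin-nonneg 0≤g 0≤c t (f b)

    -- Once `p` halts, at most `s` units are left for the continuation; granting it all of `t` can
    -- only raise the value.
    valueWithin->>=-≤ : ∀ {d s p} → HaltsWithin d p → s ℕ.≤ t →
                        valueWithin g c s (p >>= f) ≤ value g′ c p
    valueWithin->>=-≤ {s = s} (return a) s≤t = valueWithin-mono 0≤g 0≤c s≤t (f a)
    valueWithin->>=-≤ {s = zero} {p} (sampleVertex _) _ = value-nonneg 0≤g′ 0≤c p
    valueWithin->>=-≤ {s = zero} {p} (degree _ _)     _ = value-nonneg 0≤g′ 0≤c p
    valueWithin->>=-≤ {s = zero} {p} (neighbor _ _ _) _ = value-nonneg 0≤g′ 0≤c p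
    valueWithin->>=-≤ {s = zero} {p} (randomFin _ _)  _ = value-nonneg 0≤g′ 0≤c p
    valueWithin->>=-≤ {s = zero} {p} (step _)         _ = value-nonneg 0≤g′ 0≤c p
    valueWithin->>=-≤ {s = suc s} (sampleVertex h) s<t =
      +-monoʳ-≤ c (average-mono n (λ v → valueWithin->>=-≤ (h v) (ℕ.<⇒≤ s<t)))
    valueWithin->>=-≤ {s = suc s} (degree v h) s<t =
      +-monoʳ-≤ c (subst (_≤ _) (sym (average₁ _)) (valueWithin->>=-≤ (h (deg G v)) (ℕ.<⇒≤ s<t)))
    valueWithin->>=-≤ {s = suc s} (neighbor v j h) s<t =
      +-monoʳ-≤ c (subst (_≤ _) (sym (average₁ _)) (valueWithin->>=-≤ (h (nth (ordered O v) j)) (ℕ.<⇒≤ s<t)))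
    valueWithin->>=-≤ {s = suc s} (randomFin r h) s<t =
      +-monoʳ-≤ c (average-mono r (λ i → valueWithin->>=-≤ (h i) (ℕ.<⇒≤ s<t)))
    valueWithin->>=-≤ {s = suc s} (step h) s<t =
      +-monoʳ-≤ c (subst (_≤ _) (sym (average₁ _)) (valueWithin->>=-≤ h (ℕ.<⇒≤ s<t)))

    -- The counterpart of the previous bound: `p` uses at most `d` units, so out of `d + t` at least
    -- `t` remain for the continuation.
    ≤-valueWithin->>= : ∀ {d p} → HaltsWithin d p →
                        value g′ c p ≤ valueWithin g c (d ℕ.+ t) (p >>= f)
    ≤-valueWithin->>= {d} (return a)   = valueWithin-mono 0≤g 0≤c (ℕ.m≤n+m t d) (f a)
    ≤-valueWithin->>= (sampleVertex h) = +-monoʳ-≤ c (average-mono n (λ v → ≤-valueWithin->>= (h v)))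
    ≤-valueWithin->>= (degree v h)     =
      +-monoʳ-≤ c (subst (_ ≤_) (sym (average₁ _)) (≤-valueWithin->>= (h (deg G v))))
    ≤-valueWithin->>= (neighbor v j h) =
      +-monoʳ-≤ c (subst (_ ≤_) (sym (average₁ _)) (≤-valueWithin->>= (h (nth (ordered O v) j))))
    ≤-valueWithin->>= (randomFin r h)  = +-monoʳ-≤ c (average-mono r (λ i → ≤-valueWithin->>= (h i)))
    ≤-valueWithin->>= (step h)         =
      +-monoʳ-≤ c (subst (_ ≤_) (sym (average₁ _)) (≤-valueWithin->>= h))

  -- Each round of `repeat b return` costs one unit for the unfolding.
  repeat-limit : ∀ {A} {g : A → ℚ} {c p L d} {b : Program n (Maybe A)} →
    (∀ a → 0ℚ ≤ g a) → 0ℚ ≤ c → HaltsWithin d b →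
    0ℚ < p → value isNothing 0ℚ b + p ≡ 1ℚ → p * L ≡ c + value (maybe g 0ℚ) c b →
    (λ t → valueWithin g c t (repeat b return)) ⟶ L
  repeat-limit {A} {g} {c} {p} {L} {d} {b} 0≤g 0≤c halts 0<p f+p≡1 pL≡ =
    geometric-limit d
      (0≤+ 0≤c (value-nonneg {g = maybe g 0ℚ} (λ { (just a) → 0≤g a ; nothing → ≤-refl }) 0≤c b))
      (value-nonneg {g = isNothing} (λ { (just a) → ≤-refl ; nothing → <⇒≤ 0<1 }) ≤-refl b)
      0<p f+p≡1 pL≡ refl
      (λ t → valueWithin-nonneg 0≤g 0≤c t (repeat b return))
      (λ t → begin
        c + average 1 (λ _ → valueWithin g c t (b >>= again))  ≡⟨ cong (_+_ c) (average₁ _) ⟩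
        c + valueWithin g c t (b >>= again)
          ≤⟨ +-monoʳ-≤ c (valueWithin->>=-≤ 0≤g 0≤c again t halts ℕ.≤-refl) ⟩
        c + value (λ a → valueWithin g c t (again a)) c b      ≡⟨ round t ⟩
        _                                                      ∎)
      (λ t → begin
        _                                                      ≡⟨ round t ⟨
        c + value (λ a → valueWithin g c t (again a)) c b
          ≤⟨ +-monoʳ-≤ c (≤-valueWithin->>= 0≤g 0≤c again t halts) ⟩
        c + valueWithin g c (d ℕ.+ t) (b >>= again)            ≡⟨ cong (_+_ c) (average₁ _) ⟨
        c + average 1 (λ _ → valueWithin g c (d ℕ.+ t) (b >>= again))  ∎)
    where
    open ≤-Reasoning
    again : Maybe A → Program n A
    again = maybe return (repeat b return)
    X : ℕ → ℚ
    X t = valueWithin g c t (repeat b return)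
    -- A success pays `g`, while a failure restarts the loop and is worth `X t`; linearity then
    -- yields the recurrence for `X`.
    split : ∀ t a → valueWithin g c t (again a) ≡ maybe g 0ℚ a + X t * isNothing a
    split t (just a) = sym (trans (cong (_+_ (g a)) (*-zeroʳ (X t))) (+-identityʳ (g a)))
    split t nothing  = sym (trans (+-identityˡ (X t * 1ℚ)) (*-identityʳ (X t)))
    swap : ∀ c u x f → c + (u + x * f) ≡ (c + u) + f * x
    swap = solve-∀ ring
    round : ∀ t → c + value (λ a → valueWithin g c t (again a)) c b ≡
                  (c + value (maybe g 0ℚ) c b) + value isNothing 0ℚ b * X t
    round t = trans
      (cong (_+_ c) (trans (value-cong (split t) b) (value-linear (maybe g 0ℚ) isNothing c (X t) b)))
      (swap c (value (maybe g 0ℚ) c b) (X t) (value isNothing 0ℚ b))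

-- Sums over neighbors and edges

indicator : ∀ {P : Set} → Dec P → ℚ
indicator p? = if does p? then 1ℚ else 0ℚ

0≤indicator : ∀ {P : Set} (p? : Dec P) → 0ℚ ≤ indicator p?
0≤indicator p? with does p?
... | true  = <⇒≤ 0<1
... | false = ≤-refl

indicator-cong : ∀ {P Q : Set} → (P → Q) → (Q → P) → (p? : Dec P) (q? : Dec Q) → indicator p? ≡ indicator q?
indicator-cong f g (yes p) (yes q) = refl
indicator-cong f g (yes p) (no ¬q) = contradiction (f p) ¬q
indicator-cong f g (no ¬p) (yes q) = contradiction (g q) ¬p
indicator-cong f g (no ¬p) (no ¬q) = refl

module _ {A : Set} where

  -- Unfolds to the expression that `IsDistributionOnEdges` uses.
  listSum : (A → ℚ) → List A → ℚ
  listSum h xs = foldr _+_ 0ℚ (map h xs)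

  length-listSum : ∀ xs → fromℕ (length xs) ≡ listSum (λ _ → 1ℚ) xs
  length-listSum []       = refl
  length-listSum (x ∷ xs) = trans (fromℕ-+ 1 (length xs)) (cong (_+_ 1ℚ) (length-listSum xs))

  listSum-filter : ∀ {P : Unary.Pred A _} (P? : Unary.Decidable P) h xs →
    listSum h (filter P? xs) ≡ listSum (λ x → indicator (P? x) * h x) xs
  listSum-filter P? h []       = refl
  listSum-filter P? h (x ∷ xs) with does (P? x)
  ... | true  = cong₂ _+_ (sym (*-identityˡ (h x))) (listSum-filter P? h xs)
  ... | false = trans (listSum-filter P? h xs) (sym (trans (cong (_+ _) (*-zeroˡ (h x))) (+-identityˡ _)))

  listSum-++ : ∀ h xs ys → listSum h (xs ++ ys) ≡ listSum h xs + listSum h ys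
  listSum-++ h []       ys = sym (+-identityˡ _)
  listSum-++ h (x ∷ xs) ys = trans (cong (_+_ (h x)) (listSum-++ h xs ys)) (sym (+-assoc (h x) _ _))

  listSum-tabulate : ∀ {n} h (f : Fin n → A) → listSum h (tabulate f) ≡ sum (λ i → h (f i))
  listSum-tabulate {zero}  h f = refl
  listSum-tabulate {suc n} h f = cong (_+_ (h (f zero))) (listSum-tabulate h (λ i → f (suc i)))

  listSum-↭ : ∀ h {xs ys} → xs ↭ ys → listSum h xs ≡ listSum h ys
  listSum-↭ h ↭.refl          = refl
  listSum-↭ h (↭.prep x p)      = cong (_+_ (h x)) (listSum-↭ h p)
  listSum-↭ h (↭.swap {xs} {ys} x y p) = trans
    (cong (λ z → h x + (h y + z)) (listSum-↭ h p)) (exchange (h x) (h y) (listSum h ys))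
    where
    exchange : ∀ a b c → a + (b + c) ≡ b + (a + c)
    exchange = solve-∀ ring
  listSum-↭ h (↭.trans p q) = trans (listSum-↭ h p) (listSum-↭ h q)

  -- Indices past the end of the list yield `nothing` and contribute 0. This is the case of the
  -- first step of an attempt, whose index ranges up to θ and may exceed the degree.
  sum-nth : ∀ h k xs → length xs ℕ.≤ k →
            sum {k} (λ j → maybe h 0ℚ (nth xs (suc (toℕ j)))) ≡ listSum h xs
  sum-nth h k       []       _       = trans (sum-cong-≗ {k} (λ j → nth-[] (toℕ j))) (sum-0 k)
    where
    nth-[] : ∀ j → maybe h 0ℚ (nth [] (suc j)) ≡ 0ℚ
    nth-[] zero    = refl
    nth-[] (suc j) = refl
  sum-nth h (suc k) (x ∷ xs) (s≤s l) = cong (_+_ (h x)) (sum-nth h k xs l)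

listSum-map : ∀ {A B : Set} h (f : A → B) xs → listSum h (map f xs) ≡ listSum (λ x → h (f x)) xs
listSum-map h f []       = refl
listSum-map h f (x ∷ xs) = cong (_+_ (h (f x))) (listSum-map h f xs)

listSum-cartesianProduct : ∀ {A B : Set} h (xs : List A) (ys : List B) →
  listSum h (cartesianProduct xs ys) ≡ listSum (λ x → listSum (λ y → h (x , y)) ys) xs
listSum-cartesianProduct h []       ys = refl
listSum-cartesianProduct h (x ∷ xs) ys = trans
  (listSum-++ h (map (_,_ x) ys) (cartesianProduct xs ys))
  (cong₂ _+_ (listSum-map h (_,_ x) ys) (listSum-cartesianProduct h xs ys))

module _ {n : ℕ} (G : Graph n) where
  open Graph G

  adjacency : Fin n → Fin n → ℚ
  adjacency u v = indicator (adj? u v)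

  0≤adjacency : ∀ u v → 0ℚ ≤ adjacency u v
  0≤adjacency u v = 0≤indicator (adj? u v)

  adjacency-sym : ∀ u v → adjacency u v ≡ adjacency v u
  adjacency-sym u v = indicator-cong symmetric symmetric (adj? u v) (adj? v u)

  listSum-neighbors : ∀ h u → listSum h (neighbors G u) ≡ sum (λ v → adjacency u v * h v)
  listSum-neighbors h u = trans (listSum-filter (adj? u) h (allFin n))
    (listSum-tabulate (λ v → adjacency u v * h v) (λ v → v))

  listSum-edges : ∀ h → listSum h (edges G) ≡ sum (λ u → sum (λ v → adjacency u v * h (u , v)))
  listSum-edges h = begin
    listSum h (edges G)
      ≡⟨ listSum-filter (λ e → adj? (proj₁ e) (proj₂ e)) h (cartesianProduct (allFin n) (allFin n)) ⟩
    listSum h′ (cartesianProduct (allFin n) (allFin n))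
      ≡⟨ listSum-cartesianProduct h′ (allFin n) (allFin n) ⟩
    listSum (λ u → listSum (λ v → h′ (u , v)) (allFin n)) (allFin n)
      ≡⟨ listSum-tabulate (λ u → listSum (λ v → h′ (u , v)) (allFin n)) (λ u → u) ⟩
    sum (λ u → listSum (λ v → h′ (u , v)) (allFin n))
      ≡⟨ sum-cong-≗ (λ u → listSum-tabulate (λ v → h′ (u , v)) (λ v → v)) ⟩
    sum (λ u → sum (λ v → h′ (u , v)))                                    ∎
    where
    open ≡-Reasoning
    h′ : Fin n × Fin n → ℚ
    h′ e = adjacency (proj₁ e) (proj₂ e) * h e

  sum-adjacency : ∀ u → sum (adjacency u) ≡ fromℕ (deg G u)
  sum-adjacency u = sym (trans (length-listSum (neighbors G u))
    (trans (listSum-neighbors (λ _ → 1ℚ) u) (sum-cong-≗ (λ v → *-identityʳ (adjacency u v)))))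

  sum-deg : sum (λ u → fromℕ (deg G u)) ≡ fromℕ (∣E∣ G)
  sum-deg = sym (trans (length-listSum (edges G)) (trans (listSum-edges (λ _ → 1ℚ))
    (sum-cong-≗ (λ u → trans (sum-cong-≗ (λ v → *-identityʳ (adjacency u v))) (sum-adjacency u)))))

module _ {n : ℕ} {G : Graph n} (O : NeighborOrdering G) where

  -- Covers both draws of the algorithm: from θ indices at the start vertex and from exactly
  -- `deg G v` indices during the walk. Each neighbor is hit with probability 1/k, and the ordering
  -- drops out because sums are invariant under permutation. The charge `c + c` is for the draw and
  -- the query.
  value-query : ∀ {A} {g : A → ℚ} {c k} v {K : Fin k → Maybe (Fin n) → Program n A} {φ : Fin n → ℚ} →
    0 ℕ.< k → deg G v ℕ.≤ k →
    (∀ j → value O g c (K j nothing) ≡ 0ℚ) → (∀ j w → value O g c (K j (just w)) ≡ φ w) →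
    value O g c (randomFin k (λ j → neighbor v (suc (toℕ j)) (K j))) ≡
    (c + c) + recip k * sum (λ w → adjacency G v w * φ w)
  value-query {g = g} {c} {k} v {K} {φ} 0<k deg≤k fails succeeds = begin
    c + average k (λ j → c + value O g c (K j (entry j)))
      ≡⟨ cong (_+_ c) (average-cong k (λ j → cong (_+_ c) (expand j (entry j)))) ⟩
    c + average k (λ j → c + 1ℚ * maybe φ 0ℚ (entry j))
      ≡⟨ cong (_+_ c) (average-linear k (λ _ → c) (λ j → maybe φ 0ℚ (entry j)) 1ℚ) ⟩
    c + (average k (λ _ → c) + 1ℚ * average k (λ j → maybe φ 0ℚ (entry j)))
      ≡⟨ cong₂ (λ x y → c + (x + 1ℚ * (recip k * y))) (average-const c 0<k) total ⟩
    c + (c + 1ℚ * (recip k * S))                               ≡⟨ regroup c (recip k * S) ⟩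
    (c + c) + recip k * S                                      ∎
    where
    open ≡-Reasoning
    S = sum (λ w → adjacency G v w * φ w)
    entry : Fin k → Maybe (Fin n)
    entry j = nth (ordered O v) (suc (toℕ j))
    expand : ∀ j w → value O g c (K j w) ≡ 1ℚ * maybe φ 0ℚ w
    expand j (just w) = trans (succeeds j w) (sym (*-identityˡ (φ w)))
    expand j nothing  = fails j
    total : sum (λ j → maybe φ 0ℚ (entry j)) ≡ S
    total = trans
      (sum-nth φ k (ordered O v) (subst (ℕ._≤ k) (sym (↭-length (ordered-↭ O v))) deg≤k))
      (trans (listSum-↭ φ (ordered-↭ O v)) (listSum-neighbors G φ v))
    regroup : ∀ c x → c + (c + 1ℚ * x) ≡ (c + c) + x
    regroup = solve-∀ ring

module _ {n : ℕ} (G : Graph n) where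

  edgeSum : (Fin n → Fin n → ℚ) → ℚ
  edgeSum f = sum (λ u → sum (λ v → adjacency G u v * f u v))

  edgeSum-cong : ∀ {f g} → (∀ u v → f u v ≡ g u v) → edgeSum f ≡ edgeSum g
  edgeSum-cong f≗g = sum-cong-≗ (λ u → sum-cong-≗ (λ v → cong (adjacency G u v *_) (f≗g u v)))

  edgeSum-mono : ∀ {f g} → (∀ u v → f u v ≤ g u v) → edgeSum f ≤ edgeSum g
  edgeSum-mono f≤g = sum-mono (λ u → sum-mono (λ v → *-monoʳ-≤ (adjacency G u v) (0≤adjacency G u v) (f≤g u v)))

  edgeSum-linear : ∀ f g x → edgeSum (λ u v → f u v + x * g u v) ≡ edgeSum f + x * edgeSum g
  edgeSum-linear f g x = trans
    (sum-cong-≗ (λ u → trans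
      (sum-cong-≗ (λ v → distrib (adjacency G u v) (f u v) x (g u v)))
      (sum-linear (λ v → adjacency G u v * f u v) (λ v → adjacency G u v * g u v) x)))
    (sum-linear (λ u → sum (λ v → adjacency G u v * f u v)) (λ u → sum (λ v → adjacency G u v * g u v)) x)
    where
    distrib : ∀ a f x g → a * (f + x * g) ≡ a * f + x * (a * g)
    distrib = solve-∀ ring

  edgeSum-swap : ∀ f → edgeSum f ≡ edgeSum (λ u v → f v u)
  edgeSum-swap f = trans
    (∑-comm (λ u v → adjacency G u v * f u v))
    (sum-cong-≗ (λ v → sum-cong-≗ (λ u → cong (_* f u v) (adjacency-sym G u v))))

  edgeSum-source : ∀ (f : Fin n → ℚ) → edgeSum (λ u _ → f u) ≡ sum (λ u → f u * fromℕ (deg G u))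
  edgeSum-source f = sum-cong-≗ λ u → begin
    sum (λ v → adjacency G u v * f u)  ≡⟨ sum-cong-≗ (λ v → *-comm (adjacency G u v) (f u)) ⟩
    sum (λ v → f u * adjacency G u v)  ≡⟨ *-distribˡ-sum (f u) (adjacency G u) ⟨
    f u * sum (adjacency G u)          ≡⟨ cong (f u *_) (sum-adjacency G u) ⟩
    f u * fromℕ (deg G u)              ∎
    where open ≡-Reasoning

-- The walk on heavy vertices

module Threshold {n : ℕ} (G : Graph n) (θ : ℕ) where

  light? : ∀ v → Dec (deg G v ℕ.≤ θ)
  light? v = deg G v ℕ.≤? θ

  light heavy : Fin n → ℚ
  light v = indicator (light? v)
  heavy v = if does (light? v) then 0ℚ else 1ℚ

  light+heavy : ∀ v → light v + heavy v ≡ 1ℚ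
  light+heavy v with does (light? v)
  ... | true  = refl
  ... | false = refl

  0≤heavy : ∀ v → 0ℚ ≤ heavy v
  0≤heavy v with does (light? v)
  ... | true  = ≤-refl
  ... | false = <⇒≤ 0<1

  heavy≤1 : ∀ v → heavy v ≤ 1ℚ
  heavy≤1 v with does (light? v)
  ... | true  = <⇒≤ 0<1
  ... | false = ≤-refl

  -- One step of the walk from a heavy vertex.  By symmetry of adjacency this is both
  -- the expectation operator and the transport of weights against the walk.
  heavyStep : (Fin n → ℚ) → Fin n → ℚ
  heavyStep r v = heavy v * recip (deg G v) * sum (λ w → adjacency G v w * r w)

  private
    0≤rate : ∀ v → 0ℚ ≤ heavy v * recip (deg G v)
    0≤rate v = 0≤* (0≤heavy v) (0≤recip (deg G v))

  heavyStep-cong : ∀ {r s : Fin n → ℚ} → (∀ v → r v ≡ s v) → ∀ v → heavyStep r v ≡ heavyStep s v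
  heavyStep-cong r≗s v =
    cong (heavy v * recip (deg G v) *_) (sum-cong-≗ (λ w → cong (adjacency G v w *_) (r≗s w)))

  heavyStep-mono : ∀ {r s : Fin n → ℚ} → (∀ v → r v ≤ s v) → ∀ v → heavyStep r v ≤ heavyStep s v
  heavyStep-mono r≤s v = *-monoʳ-≤ (heavy v * recip (deg G v)) (0≤rate v)
    (sum-mono (λ w → *-monoʳ-≤ (adjacency G v w) (0≤adjacency G v w) (r≤s w)))

  heavyStep-linear : ∀ (r s : Fin n → ℚ) x v → heavyStep (λ w → r w + x * s w) v ≡ heavyStep r v + x * heavyStep s v
  heavyStep-linear r s x v = trans
    (cong (heavy v * recip (deg G v) *_) (trans
      (sum-cong-≗ (λ w → distrib (adjacency G v w) (r w) x (s w)))
      (sum-linear (λ w → adjacency G v w * r w) (λ w → adjacency G v w * s w) x)))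
    (distrib (heavy v * recip (deg G v)) (sum (λ w → adjacency G v w * r w)) x (sum (λ w → adjacency G v w * s w)))
    where
    distrib : ∀ a f x g → a * (f + x * g) ≡ a * f + x * (a * g)
    distrib = solve-∀ ring

  -- The extra step is applied innermost, so that absorbing the first step of a walk into its
  -- initial weight, as `edgeSum-walk` does, matches by definition.
  heavySteps : ℕ → (Fin n → ℚ) → Fin n → ℚ
  heavySteps zero    r = r
  heavySteps (suc i) r = heavySteps i (heavyStep r)

  heavySteps-cong : ∀ i {r s : Fin n → ℚ} → (∀ v → r v ≡ s v) → ∀ v → heavySteps i r v ≡ heavySteps i s v
  heavySteps-cong zero    r≗s = r≗s
  heavySteps-cong (suc i) r≗s = heavySteps-cong i (heavyStep-cong r≗s)

  heavySteps-mono : ∀ i {r s : Fin n → ℚ} → (∀ v → r v ≤ s v) → ∀ v → heavySteps i r v ≤ heavySteps i s v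
  heavySteps-mono zero    r≤s = r≤s
  heavySteps-mono (suc i) r≤s = heavySteps-mono i (heavyStep-mono r≤s)

  heavySteps-linear : ∀ i (r s : Fin n → ℚ) x v →
    heavySteps i (λ w → r w + x * s w) v ≡ heavySteps i r v + x * heavySteps i s v
  heavySteps-linear zero    r s x v = refl
  heavySteps-linear (suc i) r s x v = trans
    (heavySteps-cong i (heavyStep-linear r s x) v)
    (heavySteps-linear i (heavyStep r) (heavyStep s) x v)

  -- With κ v = heavy v / deg v, both sides are the sum of r u · κ v · φ v w over all paths u, v, w.
  -- Reversing the edge from u to v turns the sum over predecessors of v into a sum over its
  -- neighbors, which is `heavyStep r v`.
  edgeSum-heavyStep : ∀ (r : Fin n → ℚ) (φ : Fin n → Fin n → ℚ) →
    edgeSum G (λ u v → r u * (heavy v * recip (deg G v) * sum (λ w → adjacency G v w * φ v w))) ≡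
    edgeSum G (λ v w → heavyStep r v * φ v w)
  edgeSum-heavyStep r φ = trans
    (edgeSum-swap G (λ u v → r u * (heavy v * recip (deg G v) * T v)))
    (sum-cong-≗ (λ v → row v (heavy v * recip (deg G v))))
    where
    T : Fin n → ℚ
    T v = sum (λ w → adjacency G v w * φ v w)
    pull : ∀ a r κ t → a * (r * (κ * t)) ≡ (κ * t) * (a * r)
    pull = solve-∀ ring
    regroup : ∀ κ t s → (κ * t) * s ≡ (κ * s) * t
    regroup = solve-∀ ring
    push : ∀ k a f → k * (a * f) ≡ a * (k * f)
    push = solve-∀ ring
    row : ∀ v κ → sum (λ u → adjacency G v u * (r u * (κ * T v))) ≡
                  sum (λ w → adjacency G v w * (κ * sum (λ u → adjacency G v u * r u) * φ v w))
    row v κ = begin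
      sum (λ u → adjacency G v u * (r u * (κ * T v)))
        ≡⟨ sum-cong-≗ (λ u → pull (adjacency G v u) (r u) κ (T v)) ⟩
      sum (λ u → (κ * T v) * (adjacency G v u * r u))
        ≡⟨ *-distribˡ-sum (κ * T v) (λ u → adjacency G v u * r u) ⟨
      (κ * T v) * s                                    ≡⟨ regroup κ (T v) s ⟩
      (κ * s) * T v
        ≡⟨ *-distribˡ-sum (κ * s) (λ w → adjacency G v w * φ v w) ⟩
      sum (λ w → (κ * s) * (adjacency G v w * φ v w))
        ≡⟨ sum-cong-≗ (λ w → push (κ * s) (adjacency G v w) (φ v w)) ⟩
      sum (λ w → adjacency G v w * (κ * s * φ v w))    ∎
      where
      open ≡-Reasoning
      s = sum (λ u → adjacency G v u * r u)

-- Halting bounds and exact values of the walk and of one attempt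

module _ {n : ℕ} {G : Graph n} (O : NeighborOrdering G) (θ : ℕ) (0<θ : 0 ℕ.< θ) where
  open Threshold G θ

  private
    query-halts : ∀ {d k v} {K : Fin k → Maybe (Fin n) → Attempt {n}} →
      (∀ j → HaltsWithin d (K j nothing)) → (∀ j w → HaltsWithin d (K j (just w))) →
      HaltsWithin (2 ℕ.+ d) (randomFin k (λ j → neighbor v (suc (toℕ j)) (K j)))
    query-halts h₀ h₁ = randomFin _ λ j → neighbor _ _ λ where
      nothing  → h₀ j
      (just w) → h₁ j w

    choice-halts : ∀ {P : Set} (p? : Dec P) {d} {p q : Attempt {n}} →
      HaltsWithin d p → HaltsWithin d q → HaltsWithin d (if does p? then p else q)
    choice-halts (yes _) hp hq = hp
    choice-halts (no _)  hp hq = hq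

  -- Each further step of the walk takes at most 4 units: degree query, comparison, draw and
  -- neighbor query.
  walk-halts : ∀ i u v → HaltsWithin (i ℕ.* 4) (walk θ i u v)
  walk-halts zero    u v = return (just (u , v))
  walk-halts (suc i) u v = degree v λ d → step (choice-halts (d ℕ.≤? θ) (return nothing)
    (query-halts (λ _ → return nothing) (λ _ → walk-halts i v)))

  samplingAttempt-halts : ∀ i → HaltsWithin (5 ℕ.+ i ℕ.* 4) (samplingAttempt θ (suc i))
  samplingAttempt-halts i = sampleVertex λ u → degree u λ d → step (choice-halts (d ℕ.≤? θ)
    (query-halts (λ _ → return nothing) (λ _ → walk-halts i u)) (return nothing))

  module _ {g : Maybe (Fin n × Fin n) → ℚ} {c : ℚ} (fails : g nothing ≡ 0ℚ) where

    -- The degree query and the comparison are always paid; only a heavy vertex pays for the draw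
    -- and the neighbor query and continues. A light vertex ends in failure, whose payoff is 0 by
    -- `fails`.
    value-walk : ∀ i u v → value O g c (walk θ (suc i) u v) ≡
      (c + c) + (heavy v * (c + c) +
        heavy v * recip (deg G v) * sum (λ w → adjacency G v w * value O g c (walk θ i v w)))
    value-walk i u v = trans
      (cong (λ x → c + (c + x))
        (choice (light? v) (λ d≰θ → ℕ.≤-<-trans z≤n (ℕ.≰⇒> d≰θ)) (λ _ → fails) (λ _ _ → refl)))
      (expand c (heavy v) (recip (deg G v)) (sum (λ w → adjacency G v w * value O g c (walk θ i v w))))
      where
      -- Stated for an arbitrary decision so that it can be split by pattern matching. The premise
      -- on `¬ P` says that a heavy vertex has positive degree, so that the draw is from a nonempty
      -- range.
      choice : ∀ {P : Set} (p? : Dec P) {K : Fin (deg G v) → Maybe (Fin n) → Attempt {n}} {φ : Fin n → ℚ} →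
        (¬ P → 0 ℕ.< deg G v) →
        (∀ j → value O g c (K j nothing) ≡ 0ℚ) → (∀ j w → value O g c (K j (just w)) ≡ φ w) →
        value O g c (if does p? then fail else randomFin (deg G v) λ j → neighbor v (suc (toℕ j)) (K j)) ≡
        (if does p? then 0ℚ else 1ℚ) * ((c + c) + recip (deg G v) * sum (λ w → adjacency G v w * φ w))
      choice (yes _) {φ = φ} _ _ _ =
        trans fails (sym (*-zeroˡ ((c + c) + recip (deg G v) * sum (λ w → adjacency G v w * φ w))))
      choice (no ¬p) {K} {φ} 0<d h₀ h₁ =
        trans (value-query O {g = g} {c} v {K} {φ} (0<d ¬p) ℕ.≤-refl h₀ h₁) (sym (*-identityˡ _))
      expand : ∀ c h d s → c + (c + h * ((c + c) + d * s)) ≡ (c + c) + (h * (c + c) + h * d * s)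
      expand = solve-∀ ring

    value-samplingAttempt : ∀ i → value O g c (samplingAttempt θ (suc i)) ≡
      c + average n (λ u → (c + c) + light u *
        ((c + c) + recip θ * sum (λ w → adjacency G u w * value O g c (walk θ i u w))))
    value-samplingAttempt i = cong (_+_ c) (average-cong n λ u →
      trans (sym (+-assoc c c _))
        (cong (_+_ (c + c)) (choice u (light? u) (λ d≤θ → d≤θ) (λ _ → fails) (λ _ _ → refl))))
      where
      choice : ∀ {P : Set} u (p? : Dec P) {K : Fin θ → Maybe (Fin n) → Attempt {n}} {φ : Fin n → ℚ} →
        (P → deg G u ℕ.≤ θ) →
        (∀ j → value O g c (K j nothing) ≡ 0ℚ) → (∀ j w → value O g c (K j (just w)) ≡ φ w) →
        value O g c (if does p? then (randomFin θ λ j → neighbor u (suc (toℕ j)) (K j)) else fail) ≡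
        indicator p? * ((c + c) + recip θ * sum (λ w → adjacency G u w * φ w))
      choice u (yes p) {K} {φ} d≤θ h₀ h₁ =
        trans (value-query O {g = g} {c} u {K} {φ} 0<θ (d≤θ p) h₀ h₁) (sym (*-identityˡ _))
      choice u (no _)  {φ = φ} _ _ _ =
        trans fails (sym (*-zeroˡ ((c + c) + recip θ * sum (λ w → adjacency G u w * φ w))))

-- First light vertex of a walk and decay of the deficit

sum-telescope : ∀ k (d : ℕ → ℚ) → sum {k} (λ i → d (toℕ i) + - 1ℚ * d (suc (toℕ i))) ≡ d 0 - d k
sum-telescope zero    d = sym (+-inverseʳ (d 0))
sum-telescope (suc k) d = trans
  (cong (_+_ (d 0 + - 1ℚ * d 1)) (sum-telescope k (λ i → d (suc i))))
  (cancel (d 0) (d 1) (d (suc k)))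
  where
  cancel : ∀ x y z → (x + - 1ℚ * y) + (y - z) ≡ x - z
  cancel = solve-∀ ring

indicator≤1 : ∀ {P : Set} (p? : Dec P) → indicator p? ≤ 1ℚ
indicator≤1 p? with does p?
... | true  = ≤-refl
... | false = <⇒≤ 0<1

module _ {n : ℕ} (G : Graph n) where

  edgeSum-sum : ∀ {k} (f : Fin k → Fin n → Fin n → ℚ) →
                sum (λ i → edgeSum G (f i)) ≡ edgeSum G (λ u v → sum (λ i → f i u v))
  edgeSum-sum f = trans
    (∑-comm (λ i u → sum (λ v → adjacency G u v * f i u v)))
    (sum-cong-≗ λ u → trans
      (∑-comm (λ i v → adjacency G u v * f i u v))
      (sum-cong-≗ λ v → sym (*-distribˡ-sum (adjacency G u v) (λ i → f i u v))))

  edgeSum-scale : ∀ x (f : Fin n → Fin n → ℚ) → edgeSum G (λ u v → x * f u v) ≡ x * edgeSum G f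
  edgeSum-scale x f = begin
    edgeSum G (λ u v → x * f u v)                     ≡⟨ edgeSum-cong G (λ u v → split x (f u v)) ⟩
    edgeSum G (λ u v → f u v + (x - 1ℚ) * f u v)      ≡⟨ edgeSum-linear G f f (x - 1ℚ) ⟩
    edgeSum G f + (x - 1ℚ) * edgeSum G f              ≡⟨ split x (edgeSum G f) ⟨
    x * edgeSum G f                                   ∎
    where
    open ≡-Reasoning
    split : ∀ x y → x * y ≡ y + (x - 1ℚ) * y
    split = solve-∀ ring

  edgeSum-1 : edgeSum G (λ _ _ → 1ℚ) ≡ fromℕ (∣E∣ G)
  edgeSum-1 = trans (edgeSum-source G (λ _ → 1ℚ))
    (trans (sum-cong-≗ (λ u → *-identityˡ (fromℕ (deg G u)))) (sum-deg G))

module HeavySteps {n : ℕ} (G : Graph n) (θ : ℕ) where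
  open Threshold G θ

  heavySum : Fin n → ℚ
  heavySum v = sum (λ w → adjacency G v w * heavy w)

  -- Under the factor `heavy v` the degree may be assumed to exceed θ, since at a light vertex both
  -- sides vanish.
  heavy*-mono : ∀ v {x y} → (θ ℕ.< deg G v → x ≤ y) → heavy v * x ≤ heavy v * y
  heavy*-mono v = weigh (light? v) (λ d≰θ → ℕ.≰⇒> d≰θ)
    where
    weigh : ∀ {P Q : Set} (p? : Dec P) {x y} → (¬ P → Q) → (Q → x ≤ y) →
            (if does p? then 0ℚ else 1ℚ) * x ≤ (if does p? then 0ℚ else 1ℚ) * y
    weigh (yes _) {x} {y} _ _   = ≤-reflexive (trans (*-zeroˡ x) (sym (*-zeroˡ y)))
    weigh (no ¬p) q x≤y = *-monoʳ-≤ 1ℚ (<⇒≤ 0<1) (x≤y (q ¬p))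

  heavy*-cong : ∀ v {x y} → (θ ℕ.< deg G v → x ≡ y) → heavy v * x ≡ heavy v * y
  heavy*-cong v x≡y = ≤-antisym (heavy*-mono v (λ h → ≤-reflexive (x≡y h)))
                                (heavy*-mono v (λ h → ≤-reflexive (sym (x≡y h))))

  -- The factor `heavy v` excludes degree 0, where `recip` takes its default value 0.
  heavy-recip-deg : ∀ v → heavy v * (recip (deg G v) * fromℕ (deg G v)) ≡ heavy v
  heavy-recip-deg v = trans
    (heavy*-cong v (λ θ<d → recip-inverse (ℕ.≤-<-trans z≤n θ<d))) (*-identityʳ (heavy v))

  heavyStep-1 : ∀ v → heavyStep (λ _ → 1ℚ) v ≡ heavy v
  heavyStep-1 v = begin
    heavy v * recip (deg G v) * sum (λ w → adjacency G v w * 1ℚ)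
      ≡⟨ cong (heavy v * recip (deg G v) *_) (sum-cong-≗ (λ w → *-identityʳ (adjacency G v w))) ⟩
    heavy v * recip (deg G v) * sum (adjacency G v)
      ≡⟨ cong (heavy v * recip (deg G v) *_) (sum-adjacency G v) ⟩
    heavy v * recip (deg G v) * fromℕ (deg G v)
      ≡⟨ *-assoc (heavy v) (recip (deg G v)) (fromℕ (deg G v)) ⟩
    heavy v * (recip (deg G v) * fromℕ (deg G v))                 ≡⟨ heavy-recip-deg v ⟩
    heavy v                                                       ∎
    where open ≡-Reasoning

  -- `light` is 1 minus `heavy`, and a step from a heavy vertex preserves total probability. In this
  -- form the sum over walk lengths telescopes.
  heavyStep-light : ∀ v → heavyStep light v ≡ heavy v + - 1ℚ * heavyStep heavy v
  heavyStep-light v = begin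
    heavyStep light v                                  ≡⟨ heavyStep-cong complement v ⟩
    heavyStep (λ w → 1ℚ + - 1ℚ * heavy w) v            ≡⟨ heavyStep-linear (λ _ → 1ℚ) heavy (- 1ℚ) v ⟩
    heavyStep (λ _ → 1ℚ) v + - 1ℚ * heavyStep heavy v
      ≡⟨ cong (_+ - 1ℚ * heavyStep heavy v) (heavyStep-1 v) ⟩
    heavy v + - 1ℚ * heavyStep heavy v                 ∎
    where
    open ≡-Reasoning
    add-sub : ∀ x y → x ≡ (x + y) + - 1ℚ * y
    add-sub = solve-∀ ring
    complement : ∀ w → light w ≡ 1ℚ + - 1ℚ * heavy w
    complement w = trans (add-sub (light w) (heavy w)) (cong (_+ - 1ℚ * heavy w) (light+heavy w))

  -- The probability that the walk from v meets no light vertex within k steps.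
  deficit : ℕ → Fin n → ℚ
  deficit k = heavySteps k heavy

  -- The term at i is the probability that the walk from v first meets a light vertex after exactly
  -- i steps. For i ≥ 1 it equals `deficit (i - 1) v - deficit i v`, so the sum telescopes.
  sum-heavySteps-light : ∀ k v → sum {suc k} (λ i → heavySteps (toℕ i) light v) ≡ 1ℚ - deficit k v
  sum-heavySteps-light k v = begin
    light v + sum {k} (λ i → heavySteps (suc (toℕ i)) light v)
      ≡⟨ cong (_+_ (light v)) (sum-cong-≗ {k} (λ i → trans
           (heavySteps-cong (toℕ i) heavyStep-light v)
           (heavySteps-linear (toℕ i) heavy (heavyStep heavy) (- 1ℚ) v))) ⟩
    light v + sum {k} (λ i → deficit (toℕ i) v + - 1ℚ * deficit (suc (toℕ i)) v)
      ≡⟨ cong (_+_ (light v)) (sum-telescope k (λ i → deficit i v)) ⟩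
    light v + (heavy v - deficit k v)  ≡⟨ +-assoc (light v) (heavy v) (- deficit k v) ⟨
    light v + heavy v - deficit k v    ≡⟨ cong (_- deficit k v) (light+heavy v) ⟩
    1ℚ - deficit k v                   ∎
    where open ≡-Reasoning

  heavySteps-nonneg : ∀ i {r : Fin n → ℚ} → (∀ v → 0ℚ ≤ r v) → ∀ v → 0ℚ ≤ heavySteps i r v
  heavySteps-nonneg zero    0≤r = 0≤r
  heavySteps-nonneg (suc i) 0≤r = heavySteps-nonneg i (λ v →
    0≤* (0≤* (0≤heavy v) (0≤recip (deg G v))) (sum-nonneg (λ w → 0≤* (0≤adjacency G v w) (0≤r w))))

  0≤deficit : ∀ k v → 0ℚ ≤ deficit k v
  0≤deficit k = heavySteps-nonneg k 0≤heavy

  volume : ℚ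
  volume = sum (λ u → heavy u * fromℕ (deg G u))

  deficitTotal : ℕ → ℚ
  deficitTotal k = sum (λ u → deficit k u * fromℕ (deg G u))

  module _ (2m≤θ² : 2 ℕ.* ∣E∣ G ℕ.≤ θ ℕ.* θ) (0<θ : 0 ℕ.< θ) where

    private
      m = fromℕ (∣E∣ G)
      H = sum heavy
      t = fromℕ θ

    private
      H≤½θ : H ≤ ½ * t
      H≤½θ = *-cancelˡ-≤ (t + t) (subst (0ℚ <_) (fromℕ-+ θ θ) (0<fromℕ (ℕ.<-≤-trans 0<θ (ℕ.m≤m+n θ θ)))) (begin
        (t + t) * H                                ≡⟨ double t H ⟩
        t * H + t * H                              ≤⟨ +-mono-≤ tH≤m tH≤m ⟩
        m + m                                      ≡⟨ fromℕ-+ (∣E∣ G) (∣E∣ G) ⟨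
        fromℕ (∣E∣ G ℕ.+ ∣E∣ G)
          ≤⟨ fromℕ-mono-≤ (subst (ℕ._≤ θ ℕ.* θ) (cong (∣E∣ G ℕ.+_) (ℕ.+-identityʳ (∣E∣ G))) 2m≤θ²) ⟩
        fromℕ (θ ℕ.* θ)                            ≡⟨ fromℕ-* θ θ ⟩
        t * t                                      ≡⟨ halve t ⟩
        (t + t) * (½ * t)                          ∎)
        where
        open ≤-Reasoning
        double : ∀ t H → (t + t) * H ≡ t * H + t * H
        double = solve-∀ ring
        halve : ∀ t → t * t ≡ (t + t) * (½ * t)
        halve = solve-∀ ring
        tH≤m : t * H ≤ m
        tH≤m = begin
          t * sum heavy                              ≡⟨ *-distribˡ-sum t heavy ⟩
          sum (λ w → t * heavy w)                    ≡⟨ sum-cong-≗ (λ w → *-comm t (heavy w)) ⟩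
          sum (λ w → heavy w * t)
            ≤⟨ sum-mono (λ w → heavy*-mono w (λ θ<d → fromℕ-mono-≤ (ℕ.<⇒≤ θ<d))) ⟩
          sum (λ w → heavy w * fromℕ (deg G w))
            ≤⟨ sum-mono (λ w → *-monoˡ-≤ (fromℕ (deg G w)) (0≤fromℕ (deg G w)) (heavy≤1 w)) ⟩
          sum (λ w → 1ℚ * fromℕ (deg G w))
            ≡⟨ sum-cong-≗ (λ w → *-identityˡ (fromℕ (deg G w))) ⟩
          sum (λ w → fromℕ (deg G w))                ≡⟨ sum-deg G ⟩
          m                                          ∎

      heavySum≤H : ∀ v → heavySum v ≤ H
      heavySum≤H v = sum-mono λ w → subst (adjacency G v w * heavy w ≤_) (*-identityˡ (heavy w))
        (*-monoˡ-≤ (heavy w) (0≤heavy w) (indicator≤1 (Graph.adj? G v w)))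

    -- There are at most m/θ ≤ θ/2 heavy vertices.
    heavySum-≤ : ∀ v → heavy v * heavySum v ≤ heavy v * (½ * fromℕ (deg G v))
    heavySum-≤ v = heavy*-mono v λ θ<d → begin
      heavySum v             ≤⟨ heavySum≤H v ⟩
      H                      ≤⟨ H≤½θ ⟩
      ½ * t                  ≤⟨ *-monoʳ-≤ ½ 0≤½ (fromℕ-mono-≤ (ℕ.<⇒≤ θ<d)) ⟩
      ½ * fromℕ (deg G v)    ∎
      where open ≤-Reasoning

    -- The bound keeps the factor `heavy v`, so that it can be iterated.
    heavyStep-heavy : ∀ v → heavyStep heavy v ≤ ½ * heavy v
    heavyStep-heavy v = begin
      heavy v * r * heavySum v       ≡⟨ regroup (heavy v) r (heavySum v) ⟩
      r * (heavy v * heavySum v)     ≤⟨ *-monoʳ-≤ r (0≤recip (deg G v)) (heavySum-≤ v) ⟩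
      r * (heavy v * (½ * d))        ≡⟨ regroup′ r (heavy v) d ⟩
      ½ * (heavy v * (r * d))        ≡⟨ cong (½ *_) (heavy-recip-deg v) ⟩
      ½ * heavy v                    ∎
      where
      open ≤-Reasoning
      r = recip (deg G v)
      d = fromℕ (deg G v)
      regroup : ∀ h r s → h * r * s ≡ r * (h * s)
      regroup = solve-∀ ring
      regroup′ : ∀ r h d → r * (h * (½ * d)) ≡ ½ * (h * (r * d))
      regroup′ = solve-∀ ring

    deficit-≤ : ∀ k v → deficit k v ≤ ½ ^ k * heavy v
    deficit-≤ zero    v = ≤-reflexive (sym (*-identityˡ (heavy v)))
    deficit-≤ (suc k) v = begin
      heavySteps k (heavyStep heavy) v                 ≤⟨ heavySteps-mono k heavyStep-heavy v ⟩
      heavySteps k (λ w → ½ * heavy w) v               ≡⟨ heavySteps-cong k (λ w → split (heavy w)) v ⟩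
      -- The scalar ½ is rewritten in the shape f + x · g to which linearity applies.
      heavySteps k (λ w → heavy w + - ½ * heavy w) v   ≡⟨ heavySteps-linear k heavy heavy (- ½) v ⟩
      deficit k v + - ½ * deficit k v                  ≡⟨ split (deficit k v) ⟨
      ½ * deficit k v                                  ≤⟨ *-monoʳ-≤ ½ 0≤½ (deficit-≤ k v) ⟩
      ½ * (½ ^ k * heavy v)                            ≡⟨ *-assoc ½ (½ ^ k) (heavy v) ⟨
      ½ ^ suc k * heavy v                              ∎
      where
      open ≤-Reasoning
      split : ∀ x → ½ * x ≡ x + - ½ * x
      split = solve-∀ ring

    -- Inclusion–exclusion over the endpoints: an edge has a heavy source, a heavy target or neither.
    volume-≤ : fromℕ 3 * volume ≤ fromℕ 2 * m
    -- The inner chain proves 3/2 · `volume` ≤ m: edges with a heavy source and edges with a heavy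
    -- target number `volume` each, and those with both, counted by `B`, at most half of that.
    -- Doubling clears the fraction.
    volume-≤ = ≤-by (fromℕ 2 * (m - (volume + 1ℚ * (volume + - 1ℚ * (½ * volume)))))
      (0≤* (0≤fromℕ 2) (p≤q⇒0≤q-p (begin
        volume + 1ℚ * (volume + - 1ℚ * (½ * volume))
          ≤⟨ ≤-by (½ * volume - B) (p≤q⇒0≤q-p B≤½volume) (slack volume B) ⟩
        volume + 1ℚ * (volume + - 1ℚ * B)
          ≡⟨ cong₂ (λ x y → x + 1ℚ * (y + - 1ℚ * B)) source target ⟨
        edgeSum G (λ u v → heavy u) + 1ℚ * (edgeSum G (λ u v → heavy v) + - 1ℚ * B)
          ≡⟨ cong (λ x → edgeSum G (λ u v → heavy u) + 1ℚ * x)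
               (edgeSum-linear G (λ u v → heavy v) (λ u v → heavy u * heavy v) (- 1ℚ)) ⟨
        edgeSum G (λ u v → heavy u) + 1ℚ * edgeSum G (λ u v → heavy v + - 1ℚ * (heavy u * heavy v))
          ≡⟨ edgeSum-linear G (λ u v → heavy u) (λ u v → heavy v + - 1ℚ * (heavy u * heavy v)) 1ℚ ⟨
        edgeSum G (λ u v → heavy u + 1ℚ * (heavy v + - 1ℚ * (heavy u * heavy v)))
          ≤⟨ edgeSum-mono G (λ u v → ≤-by ((1ℚ - heavy u) * (1ℚ - heavy v))
               (0≤* (p≤q⇒0≤q-p (heavy≤1 u)) (p≤q⇒0≤q-p (heavy≤1 v))) (inclusion (heavy u) (heavy v))) ⟩
        edgeSum G (λ _ _ → 1ℚ)
          ≡⟨ edgeSum-1 G ⟩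
        m ∎)))
      (arrange m volume)
      where
      open ≤-Reasoning
      B = edgeSum G (λ u v → heavy u * heavy v)
      source : edgeSum G (λ u v → heavy u) ≡ volume
      source = edgeSum-source G heavy
      target : edgeSum G (λ u v → heavy v) ≡ volume
      target = trans (edgeSum-swap G (λ u v → heavy v)) source
      push : ∀ a h x → a * (h * x) ≡ h * (a * x)
      push = solve-∀ ring
      halve : ∀ h d → h * (½ * d) ≡ ½ * (h * d)
      halve = solve-∀ ring
      B≤½volume : B ≤ ½ * volume
      B≤½volume = begin
        B
          ≡⟨ sum-cong-≗ (λ u → trans
               (sum-cong-≗ (λ v → push (adjacency G u v) (heavy u) (heavy v)))
               (sym (*-distribˡ-sum (heavy u) (λ v → adjacency G u v * heavy v)))) ⟩
        sum (λ u → heavy u * heavySum u)                 ≤⟨ sum-mono heavySum-≤ ⟩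
        sum (λ u → heavy u * (½ * fromℕ (deg G u)))
          ≡⟨ sum-cong-≗ (λ u → halve (heavy u) (fromℕ (deg G u))) ⟩
        sum (λ u → ½ * (heavy u * fromℕ (deg G u)))
          ≡⟨ *-distribˡ-sum ½ (λ u → heavy u * fromℕ (deg G u)) ⟨
        ½ * volume                                       ∎
      slack : ∀ V B → V + 1ℚ * (V + - 1ℚ * B) ≡ (V + 1ℚ * (V + - 1ℚ * (½ * V))) + (½ * V - B)
      slack = solve-∀ ring
      inclusion : ∀ x y → 1ℚ ≡ (x + 1ℚ * (y + - 1ℚ * (x * y))) + (1ℚ - x) * (1ℚ - y)
      inclusion = solve-∀ ring
      arrange : ∀ m V → fromℕ 2 * m ≡ fromℕ 3 * V + fromℕ 2 * (m - (V + 1ℚ * (V + - 1ℚ * (½ * V))))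
      arrange = solve-∀ ring

    deficitTotal-≤ : ∀ k → fromℕ 3 * deficitTotal k ≤ ½ ^ k * (fromℕ 2 * m)
    deficitTotal-≤ k = begin
      fromℕ 3 * deficitTotal k
        ≤⟨ *-monoʳ-≤ (fromℕ 3) (0≤fromℕ 3) (sum-mono λ u →
             *-monoˡ-≤ (fromℕ (deg G u)) (0≤fromℕ (deg G u)) (deficit-≤ k u)) ⟩
      fromℕ 3 * sum (λ u → ½ ^ k * heavy u * fromℕ (deg G u))
                                     ≡⟨ cong (fromℕ 3 *_) (trans
           (sum-cong-≗ (λ u → *-assoc (½ ^ k) (heavy u) (fromℕ (deg G u))))
           (sym (*-distribˡ-sum (½ ^ k) (λ u → heavy u * fromℕ (deg G u))))) ⟩
      fromℕ 3 * (½ ^ k * volume)     ≡⟨ swap′ (fromℕ 3) (½ ^ k) volume ⟩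
      ½ ^ k * (fromℕ 3 * volume)     ≤⟨ *-monoʳ-≤ (½ ^ k) (^-nonneg k 0≤½) volume-≤ ⟩
      ½ ^ k * (fromℕ 2 * m)          ∎
      where
      open ≤-Reasoning
      swap′ : ∀ x y z → x * (y * z) ≡ y * (x * z)
      swap′ = solve-∀ ring

-- One round of the algorithm

module Round {n : ℕ} {G : Graph n} (O : NeighborOrdering G) (θ : ℕ) (0<θ : 0 ℕ.< θ) where
  open Threshold G θ
  open HeavySteps G θ

  round : ℕ → Attempt {n}
  round k = randomFin (suc k) λ i → samplingAttempt θ (suc (toℕ i))

  round-halts : ∀ k → HaltsWithin (6 ℕ.+ k ℕ.* 4) (round k)
  round-halts k = randomFin (suc k) λ i → HaltsWithin-mono
    (ℕ.+-monoʳ-≤ 5 (ℕ.*-monoˡ-≤ 4 (Fin.toℕ≤pred[n] i))) (samplingAttempt-halts O θ 0<θ (toℕ i))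

  module _ (g : Fin n × Fin n → ℚ) where

    -- The weight `r` is arbitrary so that the induction can absorb the first step of the walk into
    -- it.
    edgeSum-walk : ∀ i (r : Fin n → ℚ) →
      edgeSum G (λ u v → r u * value O (maybe g 0ℚ) 0ℚ (walk θ i u v)) ≡
      edgeSum G (λ u v → heavySteps i r u * g (u , v))
    edgeSum-walk zero    r = refl
    edgeSum-walk (suc i) r = begin
      edgeSum G (λ u v → r u * value O (maybe g 0ℚ) 0ℚ (walk θ (suc i) u v))
        ≡⟨ edgeSum-cong G (λ u v → cong (r u *_) (trans
             (value-walk O θ 0<θ {maybe g 0ℚ} {0ℚ} refl i u v) (uncharged (heavy v) _))) ⟩
      edgeSum G (λ u v → r u * (heavy v * recip (deg G v) * sum (λ w → adjacency G v w * W v w)))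
        ≡⟨ edgeSum-heavyStep r W ⟩
      edgeSum G (λ v w → heavyStep r v * W v w)
        ≡⟨ edgeSum-walk i (heavyStep r) ⟩
      edgeSum G (λ u v → heavySteps (suc i) r u * g (u , v)) ∎
      where
      open ≡-Reasoning
      W : Fin n → Fin n → ℚ
      W v w = value O (maybe g 0ℚ) 0ℚ (walk θ i v w)
      uncharged : ∀ h x → (0ℚ + 0ℚ) + (h * (0ℚ + 0ℚ) + x) ≡ x
      uncharged = solve-∀ ring

    -- Every edge leaving a light vertex is the first edge with the same probability 1/(nθ),
    -- whatever the degree; the walk then transports the weight `light`.
    value-attempt : ∀ i → value O (maybe g 0ℚ) 0ℚ (samplingAttempt θ (suc i)) ≡
      recip n * recip θ * edgeSum G (λ u v → heavySteps i light u * g (u , v))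
    value-attempt i = begin
      value O (maybe g 0ℚ) 0ℚ (samplingAttempt θ (suc i))
        ≡⟨ value-samplingAttempt O θ 0<θ {maybe g 0ℚ} {0ℚ} refl i ⟩
      0ℚ + recip n * sum (λ u → (0ℚ + 0ℚ) + light u * ((0ℚ + 0ℚ) + recip θ * sum (λ w → adjacency G u w * W u w)))
        ≡⟨ +-identityˡ _ ⟩
      recip n * sum (λ u → (0ℚ + 0ℚ) + light u * ((0ℚ + 0ℚ) + recip θ * sum (λ w → adjacency G u w * W u w)))
        ≡⟨ cong (recip n *_) (sum-cong-≗ row) ⟩
      recip n * sum (λ u → recip θ * sum (λ w → adjacency G u w * (light u * W u w)))
        ≡⟨ cong (recip n *_) (*-distribˡ-sum (recip θ) (λ u → sum (λ w → adjacency G u w * (light u * W u w)))) ⟨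
      recip n * (recip θ * edgeSum G (λ u w → light u * W u w))
        ≡⟨ *-assoc (recip n) (recip θ) (edgeSum G (λ u w → light u * W u w)) ⟨
      recip n * recip θ * edgeSum G (λ u w → light u * W u w)
        ≡⟨ cong (recip n * recip θ *_) (edgeSum-walk i light) ⟩
      recip n * recip θ * edgeSum G (λ u v → heavySteps i light u * g (u , v)) ∎
      where
      open ≡-Reasoning
      W : Fin n → Fin n → ℚ
      W u w = value O (maybe g 0ℚ) 0ℚ (walk θ i u w)
      uncharged : ∀ l t s → (0ℚ + 0ℚ) + l * ((0ℚ + 0ℚ) + t * s) ≡ t * (l * s)
      uncharged = solve-∀ ring
      push : ∀ l a x → l * (a * x) ≡ a * (l * x)
      push = solve-∀ ring
      row : ∀ u → (0ℚ + 0ℚ) + light u * ((0ℚ + 0ℚ) + recip θ * sum (λ w → adjacency G u w * W u w)) ≡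
                  recip θ * sum (λ w → adjacency G u w * (light u * W u w))
      row u = trans (uncharged (light u) (recip θ) (sum (λ w → adjacency G u w * W u w)))
        (cong (recip θ *_) (trans (*-distribˡ-sum (light u) (λ w → adjacency G u w * W u w))
          (sum-cong-≗ (λ w → push (light u) (adjacency G u w) (W u w)))))

    -- The k + 1 equally likely lengths correspond to first meeting a light vertex after 0, ..., k
    -- steps, so the weights of an edge add up to `1ℚ - deficit k u`.
    value-round : ∀ k → value O (maybe g 0ℚ) 0ℚ (round k) ≡
      recip (suc k) * (recip n * recip θ) * edgeSum G (λ u v → (1ℚ - deficit k u) * g (u , v))
    value-round k = begin
      0ℚ + recip (suc k) * sum {suc k} (λ i → value O (maybe g 0ℚ) 0ℚ (samplingAttempt θ (suc (toℕ i))))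
        ≡⟨ +-identityˡ _ ⟩
      recip (suc k) * sum {suc k} (λ i → value O (maybe g 0ℚ) 0ℚ (samplingAttempt θ (suc (toℕ i))))
        ≡⟨ cong (recip (suc k) *_) (sum-cong-≗ {suc k} (λ i → value-attempt (toℕ i))) ⟩
      recip (suc k) * sum {suc k} (λ i → recip n * recip θ * edgeSum G (F i))
        ≡⟨ cong (recip (suc k) *_) (*-distribˡ-sum (recip n * recip θ) (λ i → edgeSum G (F i))) ⟨
      recip (suc k) * (recip n * recip θ * sum (λ i → edgeSum G (F i)))
        ≡⟨ *-assoc (recip (suc k)) (recip n * recip θ) (sum (λ i → edgeSum G (F i))) ⟨
      recip (suc k) * (recip n * recip θ) * sum (λ i → edgeSum G (F i))
        ≡⟨ cong (recip (suc k) * (recip n * recip θ) *_) (trans (edgeSum-sum G F) (edgeSum-cong G total)) ⟩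
      recip (suc k) * (recip n * recip θ) * edgeSum G (λ u v → (1ℚ - deficit k u) * g (u , v)) ∎
      where
      open ≡-Reasoning
      F : Fin (suc k) → Fin n → Fin n → ℚ
      F i u v = heavySteps (toℕ i) light u * g (u , v)
      total : ∀ u v → sum (λ i → F i u v) ≡ (1ℚ - deficit k u) * g (u , v)
      total u v = trans (sym (*-distribʳ-sum (g (u , v)) (λ (i : Fin (suc k)) → heavySteps (toℕ i) light u)))
        (cong (_* g (u , v)) (sum-heavySteps-light k u))

  private
    -- With charge 0 its value is the total probability of all outcomes. To show that this is 1,
    -- every draw has to be from a nonempty range, since `average` is 0 on an empty one.
    𝟙 : Maybe (Fin n × Fin n) → ℚ
    𝟙 _ = 1ℚ

    query-total : ∀ {k v} {K : Fin k → Maybe (Fin n) → Attempt {n}} → 0 ℕ.< k →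
      (∀ j → value O 𝟙 0ℚ (K j nothing) ≡ 1ℚ) → (∀ j w → value O 𝟙 0ℚ (K j (just w)) ≡ 1ℚ) →
      value O 𝟙 0ℚ (randomFin k (λ j → neighbor v (suc (toℕ j)) (K j))) ≡ 1ℚ
    query-total {k} {v} {K} 0<k h₀ h₁ = trans (+-identityˡ _) (trans
      (average-cong k λ j → trans (+-identityˡ _) (each j (nth (ordered O v) (suc (toℕ j)))))
      (average-const 1ℚ 0<k))
      where
      each : ∀ j w → value O 𝟙 0ℚ (K j w) ≡ 1ℚ
      each j nothing  = h₀ j
      each j (just w) = h₁ j w

  walk-total : ∀ i u v → value O 𝟙 0ℚ (walk θ i u v) ≡ 1ℚ
  walk-total zero    u v = refl
  walk-total (suc i) u v = trans (+-identityˡ _) (trans (+-identityˡ _)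
    (choice (light? v) (λ d≰θ → ℕ.≤-<-trans z≤n (ℕ.≰⇒> d≰θ)) (λ _ → refl) (λ _ → walk-total i v)))
    where
    choice : ∀ {P : Set} (p? : Dec P) {K : Fin (deg G v) → Maybe (Fin n) → Attempt {n}} →
      (¬ P → 0 ℕ.< deg G v) →
      (∀ j → value O 𝟙 0ℚ (K j nothing) ≡ 1ℚ) → (∀ j w → value O 𝟙 0ℚ (K j (just w)) ≡ 1ℚ) →
      value O 𝟙 0ℚ (if does p? then fail else randomFin (deg G v) λ j → neighbor v (suc (toℕ j)) (K j)) ≡ 1ℚ
    choice (yes _)     _ _ _         = refl
    choice (no ¬p) {K} 0<d h₀ h₁ = query-total {v = v} {K} (0<d ¬p) h₀ h₁

  samplingAttempt-total : 0 ℕ.< n → ∀ i → value O 𝟙 0ℚ (samplingAttempt θ (suc i)) ≡ 1ℚ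
  samplingAttempt-total 0<n i = trans (+-identityˡ _) (trans
    (average-cong n λ u → trans (+-identityˡ _) (trans (+-identityˡ _)
      (choice u (light? u) (λ _ → refl) (λ _ → walk-total i u))))
    (average-const 1ℚ 0<n))
    where
    choice : ∀ {P : Set} u (p? : Dec P) {K : Fin θ → Maybe (Fin n) → Attempt {n}} →
      (∀ j → value O 𝟙 0ℚ (K j nothing) ≡ 1ℚ) → (∀ j w → value O 𝟙 0ℚ (K j (just w)) ≡ 1ℚ) →
      value O 𝟙 0ℚ (if does p? then (randomFin θ λ j → neighbor u (suc (toℕ j)) (K j)) else fail) ≡ 1ℚ
    choice u (yes _) {K} h₀ h₁ = query-total {v = u} {K} 0<θ h₀ h₁
    choice u (no _)      _  _  = refl

  round-total : 0 ℕ.< n → ∀ k → value O 𝟙 0ℚ (round k) ≡ 1ℚ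
  round-total 0<n k = trans (+-identityˡ _) (trans
    (average-cong (suc k) (λ i → samplingAttempt-total 0<n (toℕ i)))
    (average-const {suc k} 1ℚ (s≤s z≤n)))

  success : ℕ → ℚ
  success k = value O (maybe (λ _ → 1ℚ) 0ℚ) 0ℚ (round k)

  failure+success : 0 ℕ.< n → ∀ k → value O isNothing 0ℚ (round k) + success k ≡ 1ℚ
  failure+success 0<n k = begin
    value O isNothing 0ℚ (round k) + success k
      ≡⟨ cong (_+_ (value O isNothing 0ℚ (round k))) (*-identityˡ (success k)) ⟨
    value O isNothing 0ℚ (round k) + 1ℚ * success k
      ≡⟨ value-linear O isNothing (maybe (λ _ → 1ℚ) 0ℚ) 0ℚ 1ℚ (round k) ⟨
    value O (λ x → isNothing x + 1ℚ * maybe (λ _ → 1ℚ) 0ℚ x) 0ℚ (round k)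
      ≡⟨ value-cong O {c = 0ℚ} split (round k) ⟩
    value O 𝟙 0ℚ (round k)                            ≡⟨ round-total 0<n k ⟩
    1ℚ                                                ∎
    where
    open ≡-Reasoning
    split : ∀ x → isNothing x + 1ℚ * maybe (λ _ → 1ℚ) 0ℚ x ≡ 1ℚ
    split nothing  = refl
    split (just _) = refl

  module _ (2m≤θ² : 2 ℕ.* ∣E∣ G ℕ.≤ θ ℕ.* θ) where

    private
      time : Attempt {n} → ℚ
      time = value O (λ _ → 0ℚ) 1ℚ

    -- The bound B v = 2 + 8 · heavy v satisfies B v = 4 + E (B w) at a heavy vertex v with
    -- exactly half of its neighbors w heavy.
    walk-time : ∀ i u v → time (walk θ i u v) ≤ fromℕ 2 + fromℕ 8 * heavy v
    walk-time zero    u v = 0≤+ (0≤fromℕ 2) (0≤* (0≤fromℕ 8) (0≤heavy v))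
    walk-time (suc i) u v = begin
      time (walk θ (suc i) u v)
        ≡⟨ value-walk O θ 0<θ {λ _ → 0ℚ} {1ℚ} refl i u v ⟩
      (1ℚ + 1ℚ) + (h * (1ℚ + 1ℚ) + h * r * sum (λ w → adjacency G v w * time (walk θ i v w)))
        ≤⟨ +-monoʳ-≤ (1ℚ + 1ℚ) (+-monoʳ-≤ (h * (1ℚ + 1ℚ)) (*-monoʳ-≤ (h * r) (0≤* (0≤heavy v) (0≤recip (deg G v)))
             (sum-mono (λ w → *-monoʳ-≤ (adjacency G v w) (0≤adjacency G v w) (walk-time i v w))))) ⟩
      (1ℚ + 1ℚ) + (h * (1ℚ + 1ℚ) + h * r * sum (λ w → adjacency G v w * (fromℕ 2 + fromℕ 8 * heavy w)))
        ≡⟨ cong (λ x → (1ℚ + 1ℚ) + (h * (1ℚ + 1ℚ) + h * r * x)) split ⟩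
      (1ℚ + 1ℚ) + (h * (1ℚ + 1ℚ) + h * r * (fromℕ 2 * d + fromℕ 8 * heavySum v))
        ≡⟨ regroup h r d (heavySum v) ⟩
      (fromℕ 2 + fromℕ 2 * h) + (fromℕ 2 * (h * (r * d)) + fromℕ 8 * (r * (h * heavySum v)))
        ≤⟨ +-monoʳ-≤ (fromℕ 2 + fromℕ 2 * h) (+-monoʳ-≤ (fromℕ 2 * (h * (r * d)))
             (*-monoʳ-≤ (fromℕ 8) (0≤fromℕ 8) (*-monoʳ-≤ r (0≤recip (deg G v)) (heavySum-≤ 2m≤θ² 0<θ v)))) ⟩
      (fromℕ 2 + fromℕ 2 * h) + (fromℕ 2 * (h * (r * d)) + fromℕ 8 * (r * (h * (½ * d))))
        ≡⟨ collect h r d ⟩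
      (fromℕ 2 + fromℕ 2 * h) + fromℕ 6 * (h * (r * d))
        ≡⟨ cong (λ x → (fromℕ 2 + fromℕ 2 * h) + fromℕ 6 * x) (heavy-recip-deg v) ⟩
      (fromℕ 2 + fromℕ 2 * h) + fromℕ 6 * h
        ≡⟨ total h ⟩
      fromℕ 2 + fromℕ 8 * heavy v ∎
      where
      open ≤-Reasoning
      h = heavy v
      r = recip (deg G v)
      d = fromℕ (deg G v)
      distrib : ∀ a x → a * (fromℕ 2 + fromℕ 8 * x) ≡ fromℕ 2 * a + fromℕ 8 * (a * x)
      distrib = solve-∀ ring
      split : sum (λ w → adjacency G v w * (fromℕ 2 + fromℕ 8 * heavy w)) ≡ fromℕ 2 * d + fromℕ 8 * heavySum v
      split = trans (sum-cong-≗ (λ w → distrib (adjacency G v w) (heavy w)))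
        (trans (sum-linear (λ w → fromℕ 2 * adjacency G v w) (λ w → adjacency G v w * heavy w) (fromℕ 8))
          (cong (_+ fromℕ 8 * heavySum v) (trans (sym (*-distribˡ-sum (fromℕ 2) (adjacency G v)))
            (cong (fromℕ 2 *_) (sum-adjacency G v)))))
      regroup : ∀ h r d s → (1ℚ + 1ℚ) + (h * (1ℚ + 1ℚ) + h * r * (fromℕ 2 * d + fromℕ 8 * s)) ≡
        (fromℕ 2 + fromℕ 2 * h) + (fromℕ 2 * (h * (r * d)) + fromℕ 8 * (r * (h * s)))
      regroup = solve-∀ ring
      collect : ∀ h r d → (fromℕ 2 + fromℕ 2 * h) + (fromℕ 2 * (h * (r * d)) + fromℕ 8 * (r * (h * (½ * d)))) ≡
        (fromℕ 2 + fromℕ 2 * h) + fromℕ 6 * (h * (r * d))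
      collect = solve-∀ ring
      total : ∀ h → (fromℕ 2 + fromℕ 2 * h) + fromℕ 6 * h ≡ fromℕ 2 + fromℕ 8 * h
      total = solve-∀ ring

    -- 15 = 1 + 2 + 2 + 10: the vertex query, the degree query with the comparison, the draw with
    -- the neighbor query, and at most 2 + 8 for the walk. At a light start the walk is entered with
    -- probability deg/θ ≤ 1.
    samplingAttempt-time : ∀ i → time (samplingAttempt θ (suc i)) ≤ fromℕ 15
    samplingAttempt-time i = begin
      time (samplingAttempt θ (suc i))
        ≡⟨ value-samplingAttempt O θ 0<θ {λ _ → 0ℚ} {1ℚ} refl i ⟩
      1ℚ + average n (λ u → (1ℚ + 1ℚ) + light u * ((1ℚ + 1ℚ) + recip θ * sum (λ w → adjacency G u w * time (walk θ i u w))))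
        ≤⟨ +-monoʳ-≤ 1ℚ (average-≤ n (0≤fromℕ 14) λ u → +-monoʳ-≤ (1ℚ + 1ℚ)
             (choice (light? u) (0≤fromℕ 12) (λ d≤θ → +-monoʳ-≤ (1ℚ + 1ℚ) (first u d≤θ)))) ⟩
      1ℚ + fromℕ 14 ∎
      where
      open ≤-Reasoning
      choice : ∀ {P : Set} (p? : Dec P) {x y} → 0ℚ ≤ y → (P → x ≤ y) → indicator p? * x ≤ y
      choice (yes p) {x} {y} _   x≤y = subst (_≤ y) (sym (*-identityˡ x)) (x≤y p)
      choice (no _)  {x} {y} 0≤y _   = subst (_≤ y) (sym (*-zeroˡ x)) 0≤y
      walk≤10 : ∀ u w → time (walk θ i u w) ≤ fromℕ 10
      walk≤10 u w = ≤-trans (walk-time i u w) (+-monoʳ-≤ (fromℕ 2)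
        (*-monoʳ-≤ (fromℕ 8) (0≤fromℕ 8) (heavy≤1 w)))
      first : ∀ u → deg G u ℕ.≤ θ → recip θ * sum (λ w → adjacency G u w * time (walk θ i u w)) ≤ fromℕ 10
      first u d≤θ = begin
        recip θ * sum (λ w → adjacency G u w * time (walk θ i u w))
          ≤⟨ *-monoʳ-≤ (recip θ) (0≤recip θ) (sum-mono λ w →
               *-monoʳ-≤ (adjacency G u w) (0≤adjacency G u w) (walk≤10 u w)) ⟩
        recip θ * sum (λ w → adjacency G u w * fromℕ 10)
          ≡⟨ cong (recip θ *_) (trans
               (sym (*-distribʳ-sum (fromℕ 10) (adjacency G u))) (cong (_* fromℕ 10) (sum-adjacency G u))) ⟩
        recip θ * (fromℕ (deg G u) * fromℕ 10)
          ≤⟨ *-monoʳ-≤ (recip θ) (0≤recip θ) (*-monoˡ-≤ (fromℕ 10) (0≤fromℕ 10) (fromℕ-mono-≤ d≤θ)) ⟩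
        recip θ * (fromℕ θ * fromℕ 10)
          ≡⟨ *-assoc (recip θ) (fromℕ θ) (fromℕ 10) ⟨
        recip θ * fromℕ θ * fromℕ 10
          ≡⟨ cong (_* fromℕ 10) (recip-inverse 0<θ) ⟩
        fromℕ 10 ∎

    round-time : ∀ k → time (round k) ≤ fromℕ 16
    round-time k = +-monoʳ-≤ 1ℚ (average-≤ (suc k) (0≤fromℕ 15) (λ i → samplingAttempt-time (toℕ i)))

-- Bounds from the upper cuts of log₂(1/ε) and n/√m

^-mono-≤ : ∀ {x y} i → 0ℚ ≤ x → x ≤ y → x ^ i ≤ y ^ i
^-mono-≤ zero    _   _   = ≤-refl
^-mono-≤ {x} {y} (suc i) 0≤x x≤y = ≤-trans
  (*-monoʳ-≤ x 0≤x (^-mono-≤ i 0≤x x≤y))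
  (*-monoˡ-≤ (y ^ i) (^-nonneg i (≤-trans 0≤x x≤y)) x≤y)

1^n≡1 : ∀ i → 1ℚ ^ i ≡ 1ℚ
1^n≡1 zero    = refl
1^n≡1 (suc i) = trans (*-identityˡ (1ℚ ^ i)) (1^n≡1 i)

^-≤1 : ∀ {x} i → 0ℚ ≤ x → x ≤ 1ℚ → x ^ i ≤ 1ℚ
^-≤1 {x} i 0≤x x≤1 = subst (x ^ i ≤_) (1^n≡1 i) (^-mono-≤ i 0≤x x≤1)

1≤^ : ∀ {x} i → 1ℚ ≤ x → 1ℚ ≤ x ^ i
1≤^ {x} i 1≤x = subst (_≤ x ^ i) (1^n≡1 i) (^-mono-≤ i (<⇒≤ 0<1) 1≤x)

^-antimono-≤ : ∀ {x i j} → 0ℚ ≤ x → x ≤ 1ℚ → i ℕ.≤ j → x ^ j ≤ x ^ i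
^-antimono-≤ {x} {i} {j} 0≤x x≤1 i≤j = begin
  x ^ j                    ≡⟨ cong (x ^_) (ℕ.m+[n∸m]≡n i≤j) ⟨
  x ^ (i ℕ.+ (j ℕ.∸ i))    ≡⟨ ^-homo-* x i (j ℕ.∸ i) ⟩
  x ^ i * x ^ (j ℕ.∸ i)    ≤⟨ *-monoʳ-≤ (x ^ i) (^-nonneg i 0≤x) (^-≤1 (j ℕ.∸ i) 0≤x x≤1) ⟩
  x ^ i * 1ℚ               ≡⟨ *-identityʳ (x ^ i) ⟩
  x ^ i                    ∎
  where open ≤-Reasoning

1≤^⇒1≤ : ∀ {x} i → 0ℚ ≤ x → 1ℚ ≤ x ^ suc i → 1ℚ ≤ x
1≤^⇒1≤ {x} i 0≤x 1≤xⁱ with ≤-total 1ℚ x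
... | inj₁ 1≤x = 1≤x
... | inj₂ x≤1 = ≤-trans 1≤xⁱ (subst (x ^ suc i ≤_) (*-identityʳ x)
  (*-monoʳ-≤ x 0≤x (^-≤1 i 0≤x x≤1)))

square-cancel-≤ : ∀ {x y} → 0ℚ ≤ y → x * x ≤ y * y → x ≤ y
square-cancel-≤ {x} {y} 0≤y x²≤y² with ≤-total x y
... | inj₁ x≤y = x≤y
... | inj₂ y≤x with <-cmp 0ℚ x
...   | tri< 0<x _ _ = *-cancelˡ-≤ x 0<x (≤-trans x²≤y² (*-monoˡ-≤ y 0≤y y≤x))
...   | tri≈ _ 0≡x _ = subst (_≤ y) 0≡x 0≤y
...   | tri> _ _ x<0 = ≤-trans (<⇒≤ x<0) 0≤y

-- `fromℕ k` is normalized by a gcd that does not compute for a variable `k`; the explicit form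
-- shows numerator k and denominator 1 to `log₂1/_`.
fromℕ-mkℚ : ∀ k → fromℕ k ≡ mkℚ (+ k) 0 (Coprimality.sym (Coprimality.1-coprimeTo k))
fromℕ-mkℚ k = normalize-coprime (Coprimality.sym (Coprimality.1-coprimeTo k))

numerator-denominator : ∀ {s} → 0ℚ ≤ s → s * fromℕ (↧ₙ s) ≡ fromℕ ℤ.∣ ↥ s ∣
numerator-denominator {s@(mkℚ (+ a) b _)} _ = toℚᵘ-injective (begin
  toℚᵘ (s * fromℕ (suc b))                          ≈⟨ toℚᵘ-homo-* s (fromℕ (suc b)) ⟩
  toℚᵘ s ℚᵘ.* toℚᵘ (fromℕ (suc b))                  ≈⟨ ℚᵘ.*-cong (ℚᵘ.≃-refl {toℚᵘ s}) (toℚᵘ-fromℕ (suc b)) ⟩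
  ℚᵘ.mkℚᵘ (+ a) b ℚᵘ.* ℚᵘ.mkℚᵘ (+ suc b) 0          ≈⟨ ℚᵘ.*≡* (lemma (+ a) (+ suc b)) ⟩
  ℚᵘ.mkℚᵘ (+ a) 0                                   ≈⟨ toℚᵘ-fromℕ a ⟨
  toℚᵘ (fromℕ a)                                    ∎)
  where
  open ℚᵘ.≃-Reasoning
  lemma : ∀ x y → (x ℤ.* y) ℤ.* + 1 ≡ x ℤ.* (y ℤ.* + 1)
  lemma = ℤ-Solver.solve-∀
numerator-denominator {mkℚ ℤ.-[1+ a ] b _} (*≤* ())

module _ (ε : ℝ) (ε>0 : below ε 0ℚ) (ε≤½ : ¬ below ε ½) where

  private
    two three : ℚ
    two   = fromℕ 2
    three = fromℕ 3
    ¾ = + 3 / 4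

  above-positive : ∀ {q} → above ε q → 0ℚ < q
  above-positive {q} ε<q with <-cmp 0ℚ q
  ... | tri< 0<q _ _  = 0<q
  ... | tri≈ _ refl _ = ⊥-elim (disjoint ε ε>0 ε<q)
  ... | tri> _ _ q<0  = ⊥-elim (disjoint ε (below-down ε q<0 ε>0) ε<q)

  -- ε may equal ½, so ½ itself need not lie above ε; locatedness needs a gap, and ¾ is a convenient
  -- rational beyond it.
  above-¾ : above ε ¾
  above-¾ with located ε (from-yes (½ ℚ.<? ¾))
  ... | inj₁ ½<ε = ⊥-elim (ε≤½ ½<ε)
  ... | inj₂ ε<¾ = ε<¾

  log-natural⇒ : ∀ {k} → fromℕ k ∈ log₂1/ ε → ∀ q → above ε q → 1ℚ ≤ two ^ k * q
  log-natural⇒ {k} k∈ q ε<q = subst (λ x → 1ℚ ≤ two ^ k * x) (*-identityʳ q)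
    (proj₂ (subst (_∈ log₂1/ ε) (fromℕ-mkℚ k) k∈) q ε<q)

  log-natural⇐ : ∀ {k} → (∀ q → above ε q → 1ℚ ≤ two ^ k * q) → fromℕ k ∈ log₂1/ ε
  log-natural⇐ {k} h = subst (_∈ log₂1/ ε) (sym (fromℕ-mkℚ k))
    (subst (0ℚ ≤_) (fromℕ-mkℚ k) (0≤fromℕ k) ,
     λ q ε<q → subst (λ x → 1ℚ ≤ two ^ k * x) (sym (*-identityʳ q)) (h q ε<q))

  ½^k≤above : ∀ {k} → fromℕ k ∈ log₂1/ ε → ∀ q → above ε q → ½ ^ k ≤ q
  ½^k≤above {k} k∈ q ε<q = begin
    ½ ^ k                    ≡⟨ *-identityʳ (½ ^ k) ⟨
    ½ ^ k * 1ℚ               ≤⟨ *-monoʳ-≤ (½ ^ k) (^-nonneg k 0≤½) (log-natural⇒ {k} k∈ q ε<q) ⟩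
    ½ ^ k * (two ^ k * q)    ≡⟨ *-assoc (½ ^ k) (two ^ k) q ⟨
    ½ ^ k * two ^ k * q      ≡⟨ cong (_* q) (^-distrib-* ½ two k) ⟨
    1ℚ ^ k * q               ≡⟨ cong (_* q) (1^n≡1 k) ⟩
    1ℚ * q                   ≡⟨ *-identityˡ q ⟩
    q                        ∎
    where open ≤-Reasoning

  ceiling-positive : ∀ {k} → fromℕ k ∈ log₂1/ ε → 0 ℕ.< k
  ceiling-positive {suc k} _  = s≤s z≤n
  ceiling-positive {zero}  0∈ = ⊥-elim (<⇒≱ (from-yes (1ℚ * ¾ ℚ.<? 1ℚ)) (log-natural⇒ {zero} 0∈ ¾ above-¾))
    where
    <⇒≱ : ∀ {p q} → p < q → ¬ q ≤ p
    <⇒≱ p<q q≤p = <-irrefl refl (<-≤-trans p<q q≤p)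

  ½^k≤½ : ∀ {k} → fromℕ k ∈ log₂1/ ε → ½ ^ k ≤ ½
  ½^k≤½ {k} k∈ = ^-antimono-≤ {½} {1} {k} 0≤½ (from-yes (½ ℚ.≤? 1ℚ)) (ceiling-positive {k} k∈)

  module _ {b : ℚ} (b∈ : b ∈ log₂1/ ε) where

    private
      s = ℤ.∣ ↥ b ∣
      t = ↧ₙ b
      bt≡s = numerator-denominator (proj₁ b∈)

    -- Otherwise 2ˢ(3/4)ᵗ ≤ (2 · 27/64)ˢ · 3/4 < 1.
    denominator≤3numerator : t ℕ.≤ 3 ℕ.* s
    denominator≤3numerator with t ℕ.≤? 3 ℕ.* s
    ... | yes t≤3s = t≤3s
    ... | no  t≰3s = ⊥-elim (<-irrefl refl (begin-strict
      1ℚ                                 ≤⟨ proj₂ b∈ ¾ above-¾ ⟩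
      two ^ s * ¾ ^ t
        ≤⟨ *-monoʳ-≤ (two ^ s) (^-nonneg s (0≤fromℕ 2)) (^-antimono-≤ {¾} 0≤¾ (from-yes (¾ ℚ.≤? 1ℚ)) (ℕ.≰⇒> t≰3s)) ⟩
      two ^ s * (¾ * ¾ ^ (3 ℕ.* s))      ≡⟨ cong (λ x → two ^ s * (¾ * x)) (^-assocʳ ¾ 3 s) ⟨
      two ^ s * (¾ * (¾ ^ 3) ^ s)        ≡⟨ regroup (two ^ s) ¾ ((¾ ^ 3) ^ s) ⟩
      ¾ * (two ^ s * (¾ ^ 3) ^ s)        ≡⟨ cong (¾ *_) (^-distrib-* two (¾ ^ 3) s) ⟨
      ¾ * (two * ¾ ^ 3) ^ s
        ≤⟨ *-monoʳ-≤ ¾ 0≤¾ (^-≤1 s (from-yes (0ℚ ℚ.≤? two * ¾ ^ 3)) (from-yes (two * ¾ ^ 3 ℚ.≤? 1ℚ))) ⟩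
      ¾ * 1ℚ                             <⟨ from-yes (¾ * 1ℚ ℚ.<? 1ℚ) ⟩
      1ℚ                                 ∎))
      where
      open ≤-Reasoning
      0≤¾ = from-yes (0ℚ ℚ.≤? ¾)
      regroup : ∀ x y z → x * (y * z) ≡ y * (x * z)
      regroup = solve-∀ ring

    -- Reflects log₂(4/3) > 1/3, which is all that ε < ¾ offers. It serves to absorb additive
    -- constants into a multiple of b.
    1≤3b : 1ℚ ≤ three * b
    1≤3b = *-cancelˡ-≤ (fromℕ t) (0<fromℕ {t} (s≤s z≤n)) (begin
      fromℕ t * 1ℚ             ≡⟨ *-identityʳ (fromℕ t) ⟩
      fromℕ t                  ≤⟨ fromℕ-mono-≤ denominator≤3numerator ⟩
      fromℕ (3 ℕ.* s)          ≡⟨ fromℕ-* 3 s ⟩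
      three * fromℕ s          ≡⟨ cong (three *_) bt≡s ⟨
      three * (b * fromℕ t)    ≡⟨ regroup three b (fromℕ t) ⟩
      fromℕ t * (three * b)    ∎)
      where
      open ≤-Reasoning
      regroup : ∀ x y z → x * (y * z) ≡ z * (x * y)
      regroup = solve-∀ ring

    private
      j : ℕ
      -- j = ⌊b⌋ + 1 is a natural number above b; exceeding the ceiling of an integral b by one only
      -- affects the constant.
      j = suc (s ℕ./ t)

      s≤jt : s ℕ.≤ j ℕ.* t
      s≤jt = subst (ℕ._≤ j ℕ.* t) (sym (ℕ.m≡m%n+[m/n]*n s t))
        (ℕ.+-monoˡ-≤ (s ℕ./ t ℕ.* t) (ℕ.<⇒≤ (ℕ.m%n<n s t)))

    -- From s ≤ jt follows 1 ≤ 2ˢqᵗ ≤ (2ʲq)ᵗ, and a nonnegative number whose t-th power is at least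
    -- 1 is itself at least 1.
    roundUp∈log : fromℕ j ∈ log₂1/ ε
    roundUp∈log = log-natural⇐ {j} λ q ε<q → 1≤^⇒1≤ (t ℕ.∸ 1)
      (0≤* (^-nonneg j (0≤fromℕ 2)) (<⇒≤ (above-positive ε<q))) (begin
        1ℚ                       ≤⟨ proj₂ b∈ q ε<q ⟩
        two ^ s * q ^ t
          ≤⟨ *-monoˡ-≤ (q ^ t) (^-nonneg t (<⇒≤ (above-positive ε<q))) (two^-mono {s} {j ℕ.* t} s≤jt) ⟩
        two ^ (j ℕ.* t) * q ^ t  ≡⟨ cong (_* q ^ t) (^-assocʳ two j t) ⟨
        (two ^ j) ^ t * q ^ t    ≡⟨ ^-distrib-* (two ^ j) q t ⟨
        (two ^ j * q) ^ t        ∎)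
      where
      open ≤-Reasoning
      two^-mono : ∀ {i k} → i ℕ.≤ k → two ^ i ≤ two ^ k
      two^-mono {i} {k} i≤k = begin
        two ^ i                          ≡⟨ *-identityʳ (two ^ i) ⟨
        two ^ i * 1ℚ
          ≤⟨ *-monoʳ-≤ (two ^ i) (^-nonneg i (0≤fromℕ 2)) (1≤^ (k ℕ.∸ i) (1≤fromℕ {2} (s≤s z≤n))) ⟩
        two ^ i * two ^ (k ℕ.∸ i)        ≡⟨ ^-homo-* two i (k ℕ.∸ i) ⟨
        two ^ (i ℕ.+ (k ℕ.∸ i))          ≡⟨ cong (two ^_) (ℕ.m+[n∸m]≡n i≤k) ⟩
        two ^ k                          ∎

    roundUp-≤ : fromℕ j ≤ 1ℚ + b
    roundUp-≤ = subst (_≤ 1ℚ + b) (sym (fromℕ-+ 1 (s ℕ./ t))) (+-monoʳ-≤ 1ℚ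
      (*-cancelˡ-≤ (fromℕ t) (0<fromℕ {t} (s≤s z≤n)) (begin
        fromℕ t * fromℕ (s ℕ./ t)    ≡⟨ *-comm (fromℕ t) (fromℕ (s ℕ./ t)) ⟩
        fromℕ (s ℕ./ t) * fromℕ t    ≡⟨ fromℕ-* (s ℕ./ t) t ⟨
        fromℕ (s ℕ./ t ℕ.* t)        ≤⟨ fromℕ-mono-≤ (ℕ.m/n*n≤m s t) ⟩
        fromℕ s                      ≡⟨ bt≡s ⟨
        b * fromℕ t                  ≡⟨ *-comm b (fromℕ t) ⟩
        fromℕ t * b                  ∎)))
      where open ≤-Reasoning

    -- Minimality of the ceiling gives k + 1 ≤ j + 1 ≤ b + 2, and 2 ≤ 6b.
    ceiling-≤ : ∀ {k} → IsCeiling (log₂1/ ε) k → fromℕ (suc k) ≤ fromℕ 7 * b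
    ceiling-≤ {k} (_ , least) = begin
      fromℕ (suc k)             ≡⟨ fromℕ-+ 1 k ⟩
      1ℚ + fromℕ k              ≤⟨ +-monoʳ-≤ 1ℚ (fromℕ-mono-≤ {k} {j} (least j roundUp∈log)) ⟩
      1ℚ + fromℕ j              ≤⟨ +-monoʳ-≤ 1ℚ roundUp-≤ ⟩
      1ℚ + (1ℚ + b)
        ≤⟨ ≤-by (two * (three * b - 1ℚ)) (0≤* (0≤fromℕ 2) (p≤q⇒0≤q-p 1≤3b)) (expand b) ⟩
      fromℕ 7 * b               ∎
      where
      open ≤-Reasoning
      expand : ∀ b → fromℕ 7 * b ≡ (1ℚ + (1ℚ + b)) + fromℕ 2 * (fromℕ 3 * b - 1ℚ)
      expand = solve-∀ ring

-- If the root is r + 1, minimality gives r² + 1 ≤ k, and 2r ≤ r² + 1 bounds (r + 1)² by 2(r² + 1).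
-- Rounding up thus costs at most a factor 2 in the square.
⌈√⌉²≤2k : ∀ k → 0 ℕ.< k → ⌈√ k ⌉ ℕ.* ⌈√ k ⌉ ℕ.≤ 2 ℕ.* k
⌈√⌉²≤2k k 0<k = bound ⌈√ k ⌉ (⌈√⌉-least k)
  where
  2r≤r²+1 : ∀ r → r ℕ.+ r ℕ.≤ suc (r ℕ.* r)
  2r≤r²+1 zero    = z≤n
  2r≤r²+1 (suc r) = subst (suc r ℕ.+ suc r ℕ.≤_) (expand r) (ℕ.m≤m+n (suc r ℕ.+ suc r) (r ℕ.* r))
    where
    expand : ∀ r → suc r ℕ.+ suc r ℕ.+ r ℕ.* r ≡ suc (suc r ℕ.* suc r)
    expand = ℕ-Solver.solve-∀
  bound : ∀ θ → (∀ t → k ℕ.≤ t ℕ.* t → θ ℕ.≤ t) → θ ℕ.* θ ℕ.≤ 2 ℕ.* k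
  bound zero    _     = z≤n
  bound (suc r) least = begin
    suc r ℕ.* suc r                       ≡⟨ expand r ⟩
    suc (r ℕ.* r) ℕ.+ (r ℕ.+ r)           ≤⟨ ℕ.+-monoʳ-≤ (suc (r ℕ.* r)) (2r≤r²+1 r) ⟩
    suc (r ℕ.* r) ℕ.+ suc (r ℕ.* r)       ≤⟨ ℕ.+-mono-≤ r²<k r²<k ⟩
    k ℕ.+ k                               ≡⟨ cong (k ℕ.+_) (ℕ.+-identityʳ k) ⟨
    2 ℕ.* k                               ∎
    where
    open ℕ.≤-Reasoning
    expand : ∀ r → suc r ℕ.* suc r ≡ suc (r ℕ.* r) ℕ.+ (r ℕ.+ r)
    expand = ℕ-Solver.solve-∀
    r²<k : r ℕ.* r ℕ.< k
    r²<k = ℕ.≰⇒> λ k≤r² → ℕ.<-irrefl refl (least r k≤r²)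

-- Squares are compared because the cut of n/√m speaks only of squares: n² ≤ a²m and θ² ≤ 4m give
-- (nθ)² ≤ (2am)².
n⌈√2m⌉-≤ : ∀ {n m a} → 0 ℕ.< m → a ∈ (n /√ m) →
  fromℕ n * fromℕ ⌈√ 2 ℕ.* m ⌉ ≤ fromℕ 2 * (a * fromℕ m)
n⌈√2m⌉-≤ {n} {m} {a} 0<m (0≤a , n²≤a²m) = square-cancel-≤ (0≤* (0≤fromℕ 2) (0≤* 0≤a (0≤fromℕ m))) (begin
  (fromℕ n * t) * (fromℕ n * t)                     ≡⟨ interchange (fromℕ n) t ⟩
  (fromℕ n * fromℕ n) * (t * t)                     ≡⟨ cong₂ _*_ (fromℕ-* n n) (fromℕ-* θ θ) ⟨
  fromℕ (n ℕ.* n) * fromℕ (θ ℕ.* θ)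
    ≤⟨ *-monoʳ-≤ (fromℕ (n ℕ.* n)) (0≤fromℕ (n ℕ.* n)) θ²≤4m ⟩
  fromℕ (n ℕ.* n) * (fromℕ 4 * fromℕ m)
    ≤⟨ *-monoˡ-≤ (fromℕ 4 * fromℕ m) (0≤* (0≤fromℕ 4) (0≤fromℕ m)) n²≤a²m ⟩
  a * a * fromℕ m * (fromℕ 4 * fromℕ m)             ≡⟨ regroup a (fromℕ m) ⟩
  (fromℕ 2 * (a * fromℕ m)) * (fromℕ 2 * (a * fromℕ m))  ∎)
  where
  open ≤-Reasoning
  θ = ⌈√ 2 ℕ.* m ⌉
  t = fromℕ θ
  4m : ∀ m → 2 ℕ.* (2 ℕ.* m) ≡ 4 ℕ.* m
  4m = ℕ-Solver.solve-∀
  θ²≤4m : fromℕ (θ ℕ.* θ) ≤ fromℕ 4 * fromℕ m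
  θ²≤4m = subst (fromℕ (θ ℕ.* θ) ≤_) (trans (cong fromℕ (4m m)) (fromℕ-* 4 m))
    (fromℕ-mono-≤ {θ ℕ.* θ} {2 ℕ.* (2 ℕ.* m)} (⌈√⌉²≤2k (2 ℕ.* m) (ℕ.<-≤-trans 0<m (ℕ.m≤m+n m (m ℕ.+ 0)))))
  interchange : ∀ x y → (x * y) * (x * y) ≡ (x * x) * (y * y)
  interchange = solve-∀ ring
  regroup : ∀ a m → a * a * m * (fromℕ 4 * m) ≡ (fromℕ 2 * (a * m)) * (fromℕ 2 * (a * m))
  regroup = solve-∀ ring

-- The running time and the law of the output

sum-pick : ∀ {n} (f : Fin n → ℚ) x → sum (λ i → f i * indicator (i Fin.≟ x)) ≡ f x
sum-pick {suc n} f zero = trans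
  (cong₂ _+_ (*-identityʳ (f zero)) (trans (sum-cong-≗ {n} (λ i → *-zeroʳ (f (suc i)))) (sum-0 n)))
  (+-identityʳ (f zero))
sum-pick {suc n} f (suc x) = trans
  (cong₂ _+_ (*-zeroʳ (f zero)) (sum-pick (λ i → f (suc i)) x)) (+-identityˡ (f (suc x)))

indicator-pair : ∀ {n} (u v x y : Fin n) →
  indicator ((u , v) ≟ᴱ (x , y)) ≡ indicator (u Fin.≟ x) * indicator (v Fin.≟ y)
indicator-pair u v x y = product (u Fin.≟ x) (v Fin.≟ y) ((u , v) ≟ᴱ (x , y))
  (λ { refl refl → refl }) (λ e → cong proj₁ e) (λ e → cong proj₂ e)
  where
  product : ∀ {P Q R : Set} (p? : Dec P) (q? : Dec Q) (r? : Dec R) →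
    (P → Q → R) → (R → P) → (R → Q) → indicator r? ≡ indicator p? * indicator q?
  product (yes p) (yes q) (yes r) _ _ _ = refl
  product (yes p) (yes q) (no ¬r) f _ _ = contradiction (f p q) ¬r
  product (no ¬p) q?      (yes r) _ g _ = contradiction (g r) ¬p
  product (no ¬p) q?      (no ¬r) _ _ _ = sym (*-zeroˡ (indicator q?))
  product (yes p) (no ¬q) (yes r) _ _ h = contradiction (h r) ¬q
  product (yes p) (no ¬q) (no ¬r) _ _ _ = refl

edgeSum-pick : ∀ {n} (G : Graph n) (f : Fin n → Fin n → ℚ) (x y : Fin n) →
  edgeSum G (λ u v → f u v * indicator ((u , v) ≟ᴱ (x , y))) ≡ adjacency G x y * f x y
edgeSum-pick G f x y = begin
  edgeSum G (λ u v → f u v * indicator ((u , v) ≟ᴱ (x , y)))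
    ≡⟨ sum-cong-≗ (λ u → trans
         (sum-cong-≗ (λ v → trans (cong (λ i → adjacency G u v * (f u v * i)) (indicator-pair u v x y))
           (regroup (adjacency G u v) (f u v) (indicator (u Fin.≟ x)) (indicator (v Fin.≟ y)))))
         (sum-pick (λ v → adjacency G u v * f u v * indicator (u Fin.≟ x)) y)) ⟩
  sum (λ u → adjacency G u y * f u y * indicator (u Fin.≟ x))
    ≡⟨ sum-pick (λ u → adjacency G u y * f u y) x ⟩
  adjacency G x y * f x y ∎
  where
  open ≡-Reasoning
  regroup : ∀ a f i j → a * (f * (i * j)) ≡ a * f * i * j
  regroup = solve-∀ ring

indicator-idem : ∀ {P : Set} (p? : Dec P) x → indicator p? * (indicator p? * x) ≡ indicator p? * x
indicator-idem p? x with does p?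
... | true  = *-identityˡ (1ℚ * x)
... | false = trans (*-zeroˡ (0ℚ * x)) (sym (*-zeroˡ x))

-- δ bounds the deficit of a single vertex, and Δ the total deficit.
normalize-close : ∀ {m w s z δ Δ q} → 0ℚ < m → m * w ≡ 1ℚ → s * (m - Δ) ≡ 1ℚ →
  0ℚ ≤ s → 0ℚ ≤ w → 0ℚ ≤ δ → δ ≤ ½ → δ ≤ q →
  0ℚ ≤ Δ → fromℕ 3 * Δ ≤ δ * (fromℕ 2 * m) → 1ℚ - δ ≤ z → z ≤ 1ℚ →
  ℚ∣ s * z - w ∣ ≤ q * w
normalize-close {m} {w} {s} {z} {δ} {Δ} {q} 0<m mw≡1 s[m-Δ]≡1 0≤s 0≤w 0≤δ δ≤½ δ≤q 0≤Δ Δ≤ 1-δ≤z z≤1 =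
  ≤-trans (∣-∣≤ upper lower) (*-monoˡ-≤ w 0≤w δ≤q)
  where
  open ≤-Reasoning
  -- w = 1/m is the uniform weight and s = 1/(m - Δ) the normalizing factor, which the deficit can
  -- only increase.
  w≤s : w ≤ s
  w≤s = *-cancelˡ-≤ m 0<m (≤-by (s * Δ) (0≤* 0≤s 0≤Δ) (begin-equality
    m * s                   ≡⟨ expand m s Δ ⟩
    s * (m - Δ) + s * Δ     ≡⟨ cong (_+ s * Δ) (trans s[m-Δ]≡1 (sym mw≡1)) ⟩
    m * w + s * Δ           ∎))
    where
    expand : ∀ m s Δ → m * s ≡ s * (m - Δ) + s * Δ
    expand = solve-∀ ring
  -- (1 + δ)(3 − 2δ) = 3 + δ(1 − 2δ) ≥ 3, and 3(m − Δ) ≥ (3 − 2δ)m.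
  m≤[1+δ][m-Δ] : m ≤ (1ℚ + δ) * (m - Δ)
  m≤[1+δ][m-Δ] = *-cancelˡ-≤ (fromℕ 3) (0<fromℕ {3} (s≤s z≤n)) (≤-by
    (δ * ((½ - δ) * (fromℕ 2 * m)) + (1ℚ + δ) * (δ * (fromℕ 2 * m) - fromℕ 3 * Δ))
    (0≤+ (0≤* 0≤δ (0≤* (p≤q⇒0≤q-p δ≤½) (0≤* (0≤fromℕ 2) (<⇒≤ 0<m))))
         (0≤* (0≤+ (<⇒≤ 0<1) 0≤δ) (p≤q⇒0≤q-p Δ≤)))
    (expand m δ Δ))
    where
    expand : ∀ m δ Δ → fromℕ 3 * ((1ℚ + δ) * (m - Δ)) ≡
      fromℕ 3 * m + (δ * ((½ - δ) * (fromℕ 2 * m)) + (1ℚ + δ) * (δ * (fromℕ 2 * m) - fromℕ 3 * Δ))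
    expand = solve-∀ ring
  s≤[1+δ]w : s ≤ (1ℚ + δ) * w
  s≤[1+δ]w = *-cancelˡ-≤ m 0<m (begin
    m * s                          ≤⟨ *-monoˡ-≤ s 0≤s m≤[1+δ][m-Δ] ⟩
    (1ℚ + δ) * (m - Δ) * s         ≡⟨ regroup (1ℚ + δ) (m - Δ) s ⟩
    (1ℚ + δ) * (s * (m - Δ))       ≡⟨ cong ((1ℚ + δ) *_) (trans s[m-Δ]≡1 (sym mw≡1)) ⟩
    (1ℚ + δ) * (m * w)             ≡⟨ swap′ (1ℚ + δ) m w ⟩
    m * ((1ℚ + δ) * w)             ∎)
    where
    regroup : ∀ a b s → a * b * s ≡ a * (s * b)
    regroup = solve-∀ ring
    swap′ : ∀ a b s → a * (b * s) ≡ b * (a * s)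
    swap′ = solve-∀ ring
  upper : s * z - w ≤ δ * w
  upper = begin
    s * z - w             ≤⟨ +-monoˡ-≤ (- w) (*-monoʳ-≤ s 0≤s z≤1) ⟩
    s * 1ℚ - w            ≡⟨ cong (_- w) (*-identityʳ s) ⟩
    s - w                 ≤⟨ +-monoˡ-≤ (- w) s≤[1+δ]w ⟩
    (1ℚ + δ) * w - w      ≡⟨ expand δ w ⟩
    δ * w                 ∎
    where
    expand : ∀ δ w → (1ℚ + δ) * w - w ≡ δ * w
    expand = solve-∀ ring
  lower : - (s * z - w) ≤ δ * w
  -- s ≥ w and z ≥ 1 - δ give sz ≥ wz ≥ (1 - δ)w.
  lower = ≤-by ((s - w) * z + w * (z - (1ℚ - δ)))
    (0≤+ (0≤* (p≤q⇒0≤q-p w≤s) (≤-trans (p≤q⇒0≤q-p (≤-trans δ≤½ (from-yes (½ ℚ.≤? 1ℚ)))) 1-δ≤z))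
         (0≤* 0≤w (p≤q⇒0≤q-p 1-δ≤z)))
    (expand s z w δ)
    where
    expand : ∀ s z w δ → δ * w ≡ - (s * z - w) + ((s - w) * z + w * (z - (1ℚ - δ)))
    expand = solve-∀ ring

∣E∣>0⇒n>0 : ∀ {n} (G : Graph n) → 0 ℕ.< ∣E∣ G → 0 ℕ.< n
∣E∣>0⇒n>0 {suc n} G _ = s≤s z≤n

-- Mean time and output law of the whole algorithm

module SampleEdge {n : ℕ} {G : Graph n} (O : NeighborOrdering G) (0<∣E∣ : 0 ℕ.< ∣E∣ G)
                  (k : ℕ) (½^k≤½ : ½ ^ k ≤ ½) where

  private
    θ = ⌈√ 2 ℕ.* ∣E∣ G ⌉

    2m≤θ² : 2 ℕ.* ∣E∣ G ℕ.≤ θ ℕ.* θ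
    2m≤θ² = ⌈√⌉-upper (2 ℕ.* ∣E∣ G)

    0<θ : 0 ℕ.< θ
    0<θ = positive-root θ (ℕ.<-≤-trans 0<∣E∣ (ℕ.≤-trans (ℕ.m≤m+n (∣E∣ G) (∣E∣ G ℕ.+ 0)) 2m≤θ²))
      where
      positive-root : ∀ t → 0 ℕ.< t ℕ.* t → 0 ℕ.< t
      positive-root (suc t) _ = s≤s z≤n

    0<n : 0 ℕ.< n
    0<n = ∣E∣>0⇒n>0 G 0<∣E∣

  open Threshold G θ
  open HeavySteps G θ
  open Round O θ 0<θ

  private
    m = fromℕ (∣E∣ G)
    ρ = recip (suc k) * (recip n * recip θ)
    p = success k
    δ = ½ ^ k
    Δ = deficitTotal k

    0<m : 0ℚ < m
    0<m = 0<fromℕ 0<∣E∣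

    0≤δ : 0ℚ ≤ δ
    0≤δ = ^-nonneg k 0≤½

    0≤Δ : 0ℚ ≤ Δ
    0≤Δ = sum-nonneg (λ u → 0≤* (0≤deficit k u) (0≤fromℕ (deg G u)))

    3Δ≤2δm : fromℕ 3 * Δ ≤ δ * (fromℕ 2 * m)
    3Δ≤2δm = deficitTotal-≤ 2m≤θ² 0<θ k

    0<ρ : 0ℚ < ρ
    0<ρ = 0<* (0<recip {suc k} (s≤s z≤n)) (0<* (0<recip 0<n) (0<recip 0<θ))

    -- δ ≤ ½ turns 3Δ ≤ 2δm into 3Δ ≤ m, so at least two thirds of the total edge weight survive.
    -- This bounds the success probability of a round from below.
    2m≤3[m-Δ] : fromℕ 2 * m ≤ fromℕ 3 * (m - Δ)
    2m≤3[m-Δ] = ≤-by ((½ - δ) * (fromℕ 2 * m) + (δ * (fromℕ 2 * m) - fromℕ 3 * Δ))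
      (0≤+ (0≤* (p≤q⇒0≤q-p ½^k≤½) (0≤* (0≤fromℕ 2) (<⇒≤ 0<m))) (p≤q⇒0≤q-p 3Δ≤2δm))
      (expand m δ Δ)
      where
      expand : ∀ m δ Δ → fromℕ 3 * (m - Δ) ≡
        fromℕ 2 * m + ((½ - δ) * (fromℕ 2 * m) + (δ * (fromℕ 2 * m) - fromℕ 3 * Δ))
      expand = solve-∀ ring

    0<m-Δ : 0ℚ < m - Δ
    0<m-Δ = *-cancelˡ-<-nonNeg (fromℕ 3) {{nonNegative (0≤fromℕ 3)}} (begin-strict
      fromℕ 3 * 0ℚ         ≡⟨ *-zeroʳ (fromℕ 3) ⟩
      0ℚ                   <⟨ 0<* (0<fromℕ {2} (s≤s z≤n)) 0<m ⟩
      fromℕ 2 * m          ≤⟨ 2m≤3[m-Δ] ⟩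
      fromℕ 3 * (m - Δ)    ∎)
      where open ≤-Reasoning

    edgeSum-weight : edgeSum G (λ u _ → 1ℚ - deficit k u) ≡ m - Δ
    edgeSum-weight = begin
      edgeSum G (λ u _ → 1ℚ - deficit k u)
        ≡⟨ edgeSum-cong G (λ u _ → minus 1ℚ (deficit k u)) ⟩
      edgeSum G (λ u _ → 1ℚ + - 1ℚ * deficit k u)
        ≡⟨ edgeSum-linear G (λ _ _ → 1ℚ) (λ u _ → deficit k u) (- 1ℚ) ⟩
      edgeSum G (λ _ _ → 1ℚ) + - 1ℚ * edgeSum G (λ u _ → deficit k u)
        ≡⟨ cong₂ (λ x y → x + - 1ℚ * y) (edgeSum-1 G) (edgeSum-source G (deficit k)) ⟩
      m + - 1ℚ * Δ                                    ≡⟨ minus m Δ ⟨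
      m - Δ                                           ∎
      where
      open ≡-Reasoning
      minus : ∀ x y → x - y ≡ x + - 1ℚ * y
      minus = solve-∀ ring

    success≡ : p ≡ ρ * (m - Δ)
    success≡ = trans (value-round (λ _ → 1ℚ) k) (cong (ρ *_) (trans
      (edgeSum-cong G (λ u _ → *-identityʳ (1ℚ - deficit k u))) edgeSum-weight))

    0<p : 0ℚ < p
    0<p = subst (0ℚ <_) (sym success≡) (0<* 0<ρ 0<m-Δ)

    p≤1 : p ≤ 1ℚ
    p≤1 = ≤-by (value O isNothing 0ℚ (round k))
      (value-nonneg O {g = isNothing} (λ { (just _) → ≤-refl ; nothing → <⇒≤ 0<1 }) ≤-refl (round k))
      (trans (sym (failure+success 0<n k)) (+-comm (value O isNothing 0ℚ (round k)) p))

    -- The reciprocal `r` is the expected number of rounds; only its sign and `pr≡1` are used, and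
    -- `abstract` keeps it from unfolding.
    abstract
      r : ℚ
      r = proj₁ (reciprocal 0<p)

      0<r : 0ℚ < r
      0<r = proj₁ (proj₂ (reciprocal 0<p))

      pr≡1 : p * r ≡ 1ℚ
      pr≡1 = proj₂ (proj₂ (reciprocal 0<p))

    solution : ∀ c → p * (r * c) ≡ c
    solution c = trans (sym (*-assoc p r c)) (trans (cong (_* c) pr≡1) (*-identityˡ c))

    algo = sampleEdge n (∣E∣ G) (suc k)

    algo-limit : ∀ {g : Fin n × Fin n → ℚ} {c} → (∀ e → 0ℚ ≤ g e) → 0ℚ ≤ c →
      (λ t → valueWithin O g c t algo) ⟶ (c + c) + r * (c + value O (maybe g 0ℚ) c (round k))
    algo-limit {g} {c} 0≤g 0≤c = limit-delay {X} {λ t → valueWithin O g c t algo} 2 (c + c) unfold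
      (repeat-limit O 0≤g 0≤c (round-halts k) 0<p (failure+success 0<n k) (solution (c + value O (maybe g 0ℚ) c (round k))))
      where
      X : ℕ → ℚ
      X t = valueWithin O g c t (repeat (round k) return)
      unfold : ∀ t → valueWithin O g c (2 ℕ.+ t) algo ≡ (c + c) + X t
      unfold t = trans (cong (_+_ c) (trans (average₁ _) (cong (_+_ c) (average₁ (X t)))))
        (sym (+-assoc c c (X t)))

  -- The two initial steps, then `r` rounds on average, each costing one unit for unfolding `repeat`
  -- besides its own time.
  meanTime : ℚ
  meanTime = (1ℚ + 1ℚ) + r * (1ℚ + value O (maybe (λ _ → 0ℚ) 0ℚ) 1ℚ (round k))

  expectedTime : ExpectedTime O algo meanTime
  expectedTime = limit-cong {λ t → valueWithin O (λ _ → 0ℚ) 1ℚ t algo} {λ t → truncatedTime O t algo}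
    (λ t → valueWithin-time O t algo) (algo-limit (λ _ → ≤-refl) (<⇒≤ 0<1))

  private
    roundTime = value O (maybe (λ _ → 0ℚ) 0ℚ) 1ℚ (round k)

    roundTime≤16 : roundTime ≤ fromℕ 16
    roundTime≤16 = subst (_≤ fromℕ 16)
      (value-cong O {c = 1ℚ} (λ { (just _) → refl ; nothing → refl }) (round k)) (round-time 2m≤θ² k)

    0≤meanTime : 0ℚ ≤ meanTime
    0≤meanTime = 0≤+ (0≤fromℕ 2) (0≤* (<⇒≤ 0<r) (0≤+ (<⇒≤ 0<1)
      (value-nonneg O {g = maybe (λ _ → 0ℚ) 0ℚ} (λ { (just _) → ≤-refl ; nothing → ≤-refl }) (<⇒≤ 0<1) (round k))))

    -- 19 = 2 + 1 + 16: multiplying by `p` cancels `r`, and p ≤ 1 bounds the share of the initial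
    -- steps.
    p*meanTime≤19 : p * meanTime ≤ fromℕ 19
    p*meanTime≤19 = begin
      p * meanTime
        ≡⟨ *-distribˡ-+ p (1ℚ + 1ℚ) (r * (1ℚ + roundTime)) ⟩
      p * (1ℚ + 1ℚ) + p * (r * (1ℚ + roundTime))
        ≡⟨ cong (_+_ (p * (1ℚ + 1ℚ))) (solution (1ℚ + roundTime)) ⟩
      p * (1ℚ + 1ℚ) + (1ℚ + roundTime)
        ≤⟨ +-mono-≤ (*-monoˡ-≤ (1ℚ + 1ℚ) (0≤fromℕ 2) p≤1) (+-monoʳ-≤ 1ℚ roundTime≤16) ⟩
      fromℕ 19                                                ∎
      where open ≤-Reasoning

    ℓnθ = fromℕ (suc k) * (fromℕ n * fromℕ θ)

    ℓnθ*ρ≡1 : ℓnθ * ρ ≡ 1ℚ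
    ℓnθ*ρ≡1 = begin
      ℓnθ * ρ    ≡⟨ regroup (fromℕ (suc k)) (fromℕ n) (fromℕ θ) (recip (suc k)) (recip n) (recip θ) ⟩
      (recip (suc k) * fromℕ (suc k)) * ((recip n * fromℕ n) * (recip θ * fromℕ θ))
                 ≡⟨ cong₂ _*_ (recip-inverse {suc k} (s≤s z≤n)) (cong₂ _*_ (recip-inverse 0<n) (recip-inverse 0<θ)) ⟩
      1ℚ * (1ℚ * 1ℚ)  ≡⟨⟩
      1ℚ         ∎
      where
      open ≡-Reasoning
      regroup : ∀ l n t l′ n′ t′ → (l * (n * t)) * (l′ * (n′ * t′)) ≡ (l′ * l) * ((n′ * n) * (t′ * t))
      regroup = solve-∀ ring

  -- ρ = 1/(ℓnθ) and p = ρ(m - Δ) turn 2m ≤ 3(m - Δ) into 2m · `meanTime` ≤ 3ℓnθ · 19. Here nθ ≤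
  -- 2am, and cancelling 2m leaves 57 = 3 · 19.
  meanTime-≤ : ∀ {a c} → a ∈ (n /√ ∣E∣ G) → fromℕ (suc k) ≤ c → meanTime ≤ fromℕ 57 * (a * c)
  meanTime-≤ {a} {c} a∈ ℓ≤c = *-cancelˡ-≤ (fromℕ 2 * m) (0<* (0<fromℕ {2} (s≤s z≤n)) 0<m) (begin
    fromℕ 2 * m * meanTime                        ≤⟨ *-monoˡ-≤ meanTime 0≤meanTime 2m≤3[m-Δ] ⟩
    fromℕ 3 * (m - Δ) * meanTime                  ≡⟨ insert (fromℕ 3) (m - Δ) meanTime ⟩
    fromℕ 3 * (1ℚ * ((m - Δ) * meanTime))
      ≡⟨ cong (λ x → fromℕ 3 * (x * ((m - Δ) * meanTime))) ℓnθ*ρ≡1 ⟨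
    fromℕ 3 * (ℓnθ * ρ * ((m - Δ) * meanTime))    ≡⟨ regroup (fromℕ 3) ℓnθ ρ (m - Δ) meanTime ⟩
    fromℕ 3 * (ℓnθ * (ρ * (m - Δ) * meanTime))
      ≡⟨ cong (λ x → fromℕ 3 * (ℓnθ * (x * meanTime))) success≡ ⟨
    fromℕ 3 * (ℓnθ * (p * meanTime))
      ≤⟨ *-monoʳ-≤ (fromℕ 3) (0≤fromℕ 3) (*-monoʳ-≤ ℓnθ 0≤ℓnθ p*meanTime≤19) ⟩
    fromℕ 3 * (ℓnθ * fromℕ 19)
      ≤⟨ *-monoʳ-≤ (fromℕ 3) (0≤fromℕ 3) (*-monoˡ-≤ (fromℕ 19) (0≤fromℕ 19) ℓnθ≤) ⟩
    fromℕ 3 * (c * (fromℕ 2 * (a * m)) * fromℕ 19)  ≡⟨ collect a c m ⟩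
    fromℕ 2 * m * (fromℕ 57 * (a * c))            ∎)
    where
    open ≤-Reasoning
    0≤nθ : 0ℚ ≤ fromℕ n * fromℕ θ
    0≤nθ = 0≤* (0≤fromℕ n) (0≤fromℕ θ)
    0≤ℓnθ : 0ℚ ≤ ℓnθ
    0≤ℓnθ = 0≤* (0≤fromℕ (suc k)) 0≤nθ
    ℓnθ≤ : ℓnθ ≤ c * (fromℕ 2 * (a * m))
    ℓnθ≤ = ≤-trans (*-monoˡ-≤ (fromℕ n * fromℕ θ) 0≤nθ ℓ≤c)
      (*-monoʳ-≤ c (≤-trans (0≤fromℕ (suc k)) ℓ≤c) (n⌈√2m⌉-≤ {n} {∣E∣ G} {a} 0<∣E∣ a∈))
    insert : ∀ t x y → t * x * y ≡ t * (1ℚ * (x * y))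
    insert = solve-∀ ring
    regroup : ∀ t l ρ x y → t * (l * ρ * (x * y)) ≡ t * (l * (ρ * x * y))
    regroup = solve-∀ ring
    collect : ∀ a c m → fromℕ 3 * (c * (fromℕ 2 * (a * m)) * fromℕ 19) ≡ fromℕ 2 * m * (fromℕ 57 * (a * c))
    collect = solve-∀ ring

  -- The factor `r * ρ` is 1/(m - Δ), as `rρ[m-Δ]≡1` shows, so this is the edge weight after
  -- normalization.
  law : Fin n × Fin n → ℚ
  law (u , v) = adjacency G u v * (r * ρ * (1ℚ - deficit k u))

  outputLaw : OutputLaw O _≟ᴱ_ algo law
  outputLaw e@(x , y) = limit-cong {λ t → valueWithin O g 0ℚ t algo} {λ t → returnsWithin O _≟ᴱ_ t algo e}
    (λ t → valueWithin-returns O _≟ᴱ_ e t algo)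
    (subst ((λ t → valueWithin O g 0ℚ t algo) ⟶_) limit≡
      (algo-limit (λ d → 0≤indicator (d ≟ᴱ e)) ≤-refl))
    where
    g : Fin n × Fin n → ℚ
    g d = indicator (d ≟ᴱ e)
    regroup : ∀ r ρ a w → (0ℚ + 0ℚ) + r * (0ℚ + ρ * (a * w)) ≡ a * (r * ρ * w)
    regroup = solve-∀ ring
    limit≡ : (0ℚ + 0ℚ) + r * (0ℚ + value O (maybe g 0ℚ) 0ℚ (round k)) ≡ law e
    limit≡ = trans
      (cong (λ z → (0ℚ + 0ℚ) + r * (0ℚ + z)) (trans (value-round g k)
        (cong (ρ *_) (edgeSum-pick G (λ u _ → 1ℚ - deficit k u) x y))))
      (regroup r ρ (adjacency G x y) (1ℚ - deficit k x))

  private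
    deficit≤δ : ∀ u → deficit k u ≤ δ
    deficit≤δ u = ≤-trans (deficit-≤ 2m≤θ² 0<θ k u)
      (subst (δ * heavy u ≤_) (*-identityʳ δ) (*-monoʳ-≤ δ 0≤δ (heavy≤1 u)))

    0≤1-deficit : ∀ u → 0ℚ ≤ 1ℚ - deficit k u
    0≤1-deficit u = p≤q⇒0≤q-p (≤-trans (deficit≤δ u) (≤-trans ½^k≤½ (from-yes (½ ℚ.≤? 1ℚ))))

    rρ[m-Δ]≡1 : r * ρ * (m - Δ) ≡ 1ℚ
    rρ[m-Δ]≡1 = begin
      r * ρ * (m - Δ)      ≡⟨ *-assoc r ρ (m - Δ) ⟩
      r * (ρ * (m - Δ))    ≡⟨ cong (r *_) success≡ ⟨
      r * p                ≡⟨ *-comm r p ⟩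
      p * r                ≡⟨ pr≡1 ⟩
      1ℚ                   ∎
      where open ≡-Reasoning

    0≤rρ : 0ℚ ≤ r * ρ
    0≤rρ = <⇒≤ (0<* 0<r 0<ρ)

  law-distribution : IsDistributionOnEdges G law
  law-distribution =
    (λ e → 0≤* (0≤adjacency G (proj₁ e) (proj₂ e)) (0≤* 0≤rρ (0≤1-deficit (proj₁ e)))) ,
    (begin
      listSum law (edges G)
        ≡⟨ listSum-edges G law ⟩
      edgeSum G (λ u v → adjacency G u v * (r * ρ * (1ℚ - deficit k u)))
        -- Adjacency enters twice, once from the list of edges and once from `law`.
        ≡⟨ sum-cong-≗ (λ u → sum-cong-≗ (λ v → indicator-idem (Graph.adj? G u v) (r * ρ * (1ℚ - deficit k u)))) ⟩
      edgeSum G (λ u _ → r * ρ * (1ℚ - deficit k u))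
        ≡⟨ edgeSum-scale G (r * ρ) (λ u _ → 1ℚ - deficit k u) ⟩
      r * ρ * edgeSum G (λ u _ → 1ℚ - deficit k u)
        ≡⟨ cong (r * ρ *_) edgeSum-weight ⟩
      r * ρ * (m - Δ)
        ≡⟨ rρ[m-Δ]≡1 ⟩
      1ℚ ∎)
    where open ≡-Reasoning

  law-close : ∀ {q} → δ ≤ q → ∀ e → ℚ∣ law e - uniformEdge G e ∣ ≤ q * uniformEdge G e
  law-close {q} δ≤q (u , v) with does (Graph.adj? G u v)
  ... | false = ≤-reflexive (trans
    (cong ℚ∣_∣ (trans (cong (_- 0ℚ) (*-zeroˡ (r * ρ * (1ℚ - deficit k u)))) refl)) (sym (*-zeroʳ q)))
  ... | true  = subst (λ x → ℚ∣ x - recip (∣E∣ G) ∣ ≤ q * recip (∣E∣ G))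
    (sym (*-identityˡ (r * ρ * (1ℚ - deficit k u))))
    (normalize-close 0<m (trans (*-comm m (recip (∣E∣ G))) (recip-inverse 0<∣E∣)) rρ[m-Δ]≡1
      0≤rρ (0≤recip (∣E∣ G)) 0≤δ ½^k≤½ δ≤q 0≤Δ 3Δ≤2δm
      (+-monoʳ-≤ 1ℚ (neg-antimono-≤ (deficit≤δ u)))
      (≤-by (deficit k u) (0≤deficit k u) (add-sub (deficit k u))))
    where
    add-sub : ∀ x → 1ℚ ≡ 1ℚ - x + x
    add-sub = solve-∀ ring

theorem6 :
    ∃ λ (C : ℕ) →
    (ε : ℝ) → below ε 0ℚ → ¬ below ε ½ →
    (n : ℕ) (G : Graph n) (O : NeighborOrdering G) → 0 ℕ.< ∣E∣ G →
    (k : ℕ) → IsCeiling (log₂1/ ε) k →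
    let m    = ∣E∣ G
        ℓ    = suc k
        algo = sampleEdge n m ℓ
    in
      (∃ λ τ → ExpectedTime O algo τ ×
        (∀ a b → a ∈ (n /√ m) → b ∈ (log₂1/ ε) → τ ≤ fromℕ C * (a * b)))
      ×
      (∃ λ P → OutputLaw O _≟ᴱ_ algo P ×
        IsDistributionOnEdges G P ×
        PointwiseClose ε P (uniformEdge G))
-- 399 = 57 · 7, where 57 comes from the bound in terms of ℓ and 7 from ℓ ≤ 7b.
theorem6 = 399 , λ ε ε>0 ε≤½ n G O 0<∣E∣ k ceiling →
  let open SampleEdge O 0<∣E∣ k (½^k≤½ ε ε>0 ε≤½ {k} (proj₁ ceiling)) in
  (meanTime , expectedTime , λ a b a∈ b∈ →
    subst (meanTime ≤_) (collect a b) (meanTime-≤ {a} {fromℕ 7 * b} a∈ (ceiling-≤ ε ε>0 ε≤½ b∈ ceiling))) ,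
  (law , outputLaw , law-distribution , λ e q ε<q → law-close (½^k≤above ε ε>0 ε≤½ {k} (proj₁ ceiling) q ε<q) e)
  where
  collect : ∀ a b → fromℕ 57 * (a * (fromℕ 7 * b)) ≡ fromℕ 399 * (a * b)
  collect = solve-∀ ring
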